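{- For every sentence $\phi$ of the logic $\mathsf{C}^2$, there exists a Presburger formula $\textsf{PREB}(x)$ with one free variable such that $\{n\in\mathbb{N} \mid \textsf{PREB}(n) \text{ holds}\} = \textsc{Spec}(\phi)$. Moreover, the formula $\textsf{PREB}(x)$ can be constructed effectively from $\phi$.
   Context: $\mathsf{C}^2$ (two-variable logic with counting) is the set of first-order formulas over a vocabulary of unary predicate symbols and binary predicate symbols, built from atoms $z=z$, $R(z,z)$, $P(z)$ (with $z$ ranging over the two variables $x,y$, $R$ binary, $P$ unary) using $\neg$, $\wedge$ and counting quantifiers $\exists^k z\,\phi$ ($k\ge 1$), where $\exists^k z\,\phi$ means "there are at least $k$ elements $z$ such that $\phi$ holds"; $\exists^0 z\,\phi$ always holds. The spectrum $\textsc{Spec}(\phi)$ of a sentence $\phi$ is the set of natural numbers $n$ such that $\phi$ has a finite model with exactly $n$ elements. A Presburger formula is a first-order formula in the language with $+$, $\le$, $0$, $1$, interpreted over $\mathbb{N}=\{0,1,2,\dots\}$ in the natural way. -}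

module Defs where

open import Data.Nat using (ℕ; zero; suc; _+_; _≤_; _≤ᵇ_)
open import Data.Fin using (Fin)
import Data.Fin as Fin
open import Data.Bool using (Bool; true; false; T; not; _∧_; if_then_else_)
open import Data.Product using (Σ; _×_; _,_)
open import Data.Vec using (Vec; lookup; _∷_)
open import Data.Empty using (⊥)
open import Relation.Nullary using (¬_)
open import Relation.Binary.PropositionalEquality using (_≡_)

data Var : Set where
  vx vy : Var

record Scope : Set where
  constructor scope
  field
    xb : Bool
    yb : Bool
open Scope public

bound : Scope → Var → Bool
bound s vx = xb s
bound s vy = yb s

bind : Scope → Var → Scope
bind s vx = scope true (yb s)
bind s vy = scope (xb s) true

data C2 (s : Scope) : Set where
  eq   : (z w : Var) → T (bound s z) → T (bound s w) → C2 s
  rel  : (i : ℕ) (z w : Var) → T (bound s z) → T (bound s w) → C2 s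
  una  : (i : ℕ) (z : Var) → T (bound s z) → C2 s
  neg  : C2 s → C2 s
  conj : C2 s → C2 s → C2 s
  cnt  : (k : ℕ) (z : Var) → C2 (bind s z) → C2 s

Sentence : Set
Sentence = C2 (scope false false)

record Structure (n : ℕ) : Set where
  field
    unary  : ℕ → Fin n → Bool
    binary : ℕ → Fin n → Fin n → Bool
open Structure public

Env : Scope → ℕ → Set
Env s n = (z : Var) → T (bound s z) → Fin n

emptyEnv : ∀ {n} → Env (scope false false) n
emptyEnv vx ()
emptyEnv vy ()

extend : ∀ {s n} → Env s n → (z : Var) → Fin n → Env (bind s z) n
extend ρ vx a vx _ = a
extend ρ vx a vy p = ρ vy p
extend ρ vy a vx p = ρ vx p
extend ρ vy a vy _ = a

countTrue : ∀ {n} → (Fin n → Bool) → ℕ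
countTrue {zero}  f = 0
countTrue {suc n} f = (if f Fin.zero then 1 else 0) + countTrue (λ i → f (Fin.suc i))

_≡ᶠ_ : ∀ {n} → Fin n → Fin n → Bool
a ≡ᶠ b = Data.Nat._≡ᵇ_ (Fin.toℕ a) (Fin.toℕ b)

-- Satisfaction (finite structures, so truth values are Booleans).
eval : ∀ {s n} → Structure n → C2 s → Env s n → Bool
eval M (eq z w p q)    ρ = ρ z p ≡ᶠ ρ w q
eval M (rel i z w p q) ρ = binary M i (ρ z p) (ρ w q)
eval M (una i z p)     ρ = unary M i (ρ z p)
eval M (neg φ)         ρ = not (eval M φ ρ)
eval M (conj φ ψ)      ρ = eval M φ ρ ∧ eval M ψ ρ
eval M (cnt k z φ)     ρ = k ≤ᵇ countTrue (λ a → eval M φ (extend ρ z a))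

InSpec : Sentence → ℕ → Set
InSpec φ n = Σ (Structure n) λ M → T (eval M φ emptyEnv)

data PTerm (m : ℕ) : Set where
  var  : Fin m → PTerm m
  zer  : PTerm m
  one  : PTerm m
  plus : PTerm m → PTerm m → PTerm m

data PForm (m : ℕ) : Set where
  peq  : PTerm m → PTerm m → PForm m
  ple  : PTerm m → PTerm m → PForm m
  pneg : PForm m → PForm m
  pand : PForm m → PForm m → PForm m
  pex  : PForm (suc m) → PForm m

evalT : ∀ {m} → PTerm m → Vec ℕ m → ℕ
evalT (var i)    ρ = lookup ρ i
evalT zer        ρ = 0
evalT one        ρ = 1
evalT (plus t u) ρ = evalT t ρ + evalT u ρ

PSat : ∀ {m} → PForm m → Vec ℕ m → Set
PSat (peq t u)  ρ = evalT t ρ ≡ evalT u ρ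
PSat (ple t u)  ρ = evalT t ρ ≤ evalT u ρ
PSat (pneg φ)   ρ = ¬ PSat φ ρ
PSat (pand φ ψ) ρ = PSat φ ρ × PSat ψ ρ
PSat (pex φ)    ρ = Σ ℕ λ a → PSat φ (a ∷ ρ)

{-# OPTIONS --safe #-}

-- A structure is encoded as a complete graph whose ordered pairs carry colours (both 1-types, the
-- 2-type, and the capped rank of the neighbour among those of its class), where χ b a = rev (χ a b).
-- A vertex has a palette of colours; a "unique" colour of its palette must occur on exactly one of
-- its edges, the other colours of the palette are unrestricted.  Whether the counting quantifiers hold
-- is a property of palettes, so the spectrum is determined by the realisable vectors of palette counts.
--
-- If each unique colour in use has more than a fixed number of possible other ends, and any two
-- vertices admit a colour unique at neither end, then the vector is realisable exactly when
-- the two ends of every colour unique at both ends are equinumerous: matchings exist by a swapping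
-- argument, and half-unique edges can be sent cyclically through three levels of disjoint target blocks.
-- Otherwise some vertex can be removed, replacing palettes by residual ones, while lowering a potential
-- that is bounded independently of the size of the structure.  Hence boundedly many removals lead to the
-- good case, and this is expressible by existentially quantified linear conditions on the counts.

module Submission where

open import Defs
open import Data.Nat using (ℕ; zero; suc; _+_; _*_; _^_; _∸_; _⊓_; _⊔_; _≤_; _<_; z≤n; s≤s; _≤ᵇ_; _<ᵇ_)
open import Data.Nat.Properties hiding (_≟_)
import Data.Nat.Properties as ℕₚ
open import Data.Fin using (Fin; zero; suc; _≟_; toℕ; fromℕ<; combine; remQuot; splitAt; punchIn; punchOut; _↑ˡ_; _↑ʳ_; finToFun; funToFin)
import Data.Fin.Properties as Finₚ
open import Data.Bool using (Bool; true; false; T; not; _∧_; if_then_else_)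
import Data.Bool.Properties as Boolₚ
open import Data.Maybe using (Maybe; just; nothing; _>>=_)
open import Data.Maybe.Properties using (just-injective; ≡-dec)
open import Data.List as List using (List; []; _∷_; cartesianProduct; allFin)
open import Data.List.Membership.Propositional using (_∈_)
open import Data.List.Membership.Propositional.Properties using (∈-cartesianProduct⁺; ∈-allFin)
open import Data.List.Relation.Unary.Any using (here; there)
open import Data.List.Relation.Unary.All as All using (All; []; _∷_)
import Data.List.Relation.Unary.All.Properties as Allₚ
open import Data.Vec using (Vec; []; _∷_; _++_; lookup; tabulate; replicate)
open import Data.Vec.Properties using (lookup-++ˡ; lookup-++ʳ; lookup∘tabulate)
open import Data.Product using (Σ; ∃; _×_; _,_; proj₁; proj₂)
open import Data.Sum using (_⊎_; inj₁; inj₂)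
open import Data.Unit using (⊤; tt)
open import Data.Empty using (⊥; ⊥-elim)
open import Relation.Nullary using (¬_; Dec; yes; no; does)
open import Relation.Nullary.Decidable using (_×-dec_; _⊎-dec_; ¬?; map′; dec-true)
open import Relation.Binary.Definitions using (tri<; tri≈; tri>)
open import Relation.Binary.PropositionalEquality
open import Function using (_∘_)
open import Function.Bundles using (_⇔_; mk⇔; Equivalence)

-- Ranks are capped at the largest number `K` required by a counting quantifier. All neighbours of a
-- vertex in one class satisfy the same conditions, so a class with more than `K` members already
-- supplies `K` witnesses through its unique colours, and the remaining members cannot change a
-- truth value. The real difficulty is that each pair of vertices carries a single colour while each
-- vertex insists on its own unique colours. Abundance of possible ends lets every conflict be
-- dodged; scarcity is what forces removals. A removal is linear in the counts because it only
-- matters how many vertices of each palette are joined to the removed vertex by each colour. Its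
-- potential is a sum of truncated numbers, one for each colour and one for each group of palettes
-- with the same non-unique colours; the truncation makes the bound independent of the structure.
-- Formulas are built together with their correctness proofs. Disjunction has to be encoded by
-- negation and needs decidability, so it occurs only in quantifier-free parts, below the
-- existential quantifiers.

∧-intro : ∀ {a b} → a ≡ true → b ≡ true → a ∧ b ≡ true
∧-intro refl refl = refl

∧-true : ∀ {a b} → a ∧ b ≡ true → a ≡ true × b ≡ true
∧-true {true} {true} _ = refl , refl

not-true : ∀ {a} → not a ≡ true → a ≡ false
not-true {false} _ = refl

not-false : ∀ {a} → a ≡ false → not a ≡ true
not-false refl = refl

true≢false : ∀ {a} → a ≡ true → a ≡ false → ⊥
true≢false refl ()

bool? : ∀ b → b ≡ true ⊎ b ≡ false
bool? true  = inj₁ refl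
bool? false = inj₂ refl

infix 4 _==_

_==_ : ∀ {n} → Fin n → Fin n → Bool
i == j = does (i ≟ j)

==-refl : ∀ {n} (i : Fin n) → (i == i) ≡ true
==-refl zero    = refl
==-refl (suc i) = ==-refl i

==⇒≡ : ∀ {n} (i j : Fin n) → (i == j) ≡ true → i ≡ j
==⇒≡ i j e with i ≟ j
... | yes p = p

≢⇒== : ∀ {n} {i j : Fin n} → i ≢ j → (i == j) ≡ false
≢⇒== {i = i} {j} i≢j with i ≟ j
... | yes p = ⊥-elim (i≢j p)
... | no _  = refl

==-false : ∀ {n} (i j : Fin n) → (i == j) ≡ false → i ≢ j
==-false i .i e refl = true≢false (==-refl i) e

==-sym : ∀ {n} (i j : Fin n) → (i == j) ≡ (j == i)
==-sym zero    zero    = refl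
==-sym zero    (suc j) = refl
==-sym (suc i) zero    = refl
==-sym (suc i) (suc j) = ==-sym i j

-- Counting

b2n : Bool → ℕ
b2n b = if b then 1 else 0

count-cong : ∀ {n} {f g : Fin n → Bool} → (∀ i → f i ≡ g i) → countTrue f ≡ countTrue g
count-cong {zero}  h = refl
count-cong {suc n} h = cong₂ _+_ (cong b2n (h zero)) (count-cong (h ∘ suc))

count-true : ∀ n → countTrue {n} (λ _ → true) ≡ n
count-true zero    = refl
count-true (suc n) = cong suc (count-true n)

b2n-mono : ∀ {a b} → (a ≡ true → b ≡ true) → b2n a ≤ b2n b
b2n-mono {false}         h = z≤n
b2n-mono {true}  {true}  h = ≤-refl
b2n-mono {true}  {false} h with () ← h refl

count-mono : ∀ {n} {f g : Fin n → Bool} → (∀ i → f i ≡ true → g i ≡ true) → countTrue f ≤ countTrue g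
count-mono {zero}  h = z≤n
count-mono {suc n} h = +-mono-≤ (b2n-mono (h zero)) (count-mono (h ∘ suc))

count-punchIn : ∀ {n} (f : Fin (suc n) → Bool) a →
  countTrue f ≡ b2n (f a) + countTrue (λ i → f (punchIn a i))
count-punchIn f zero = refl
count-punchIn {suc n} f (suc a) = begin
  b2n (f zero) + countTrue (f ∘ suc)
    ≡⟨ cong (b2n (f zero) +_) (count-punchIn (f ∘ suc) a) ⟩
  b2n (f zero) + (b2n (f (suc a)) + rest)
    ≡⟨ sym (+-assoc (b2n (f zero)) _ _) ⟩
  b2n (f zero) + b2n (f (suc a)) + rest
    ≡⟨ cong (_+ rest) (+-comm (b2n (f zero)) _) ⟩
  b2n (f (suc a)) + b2n (f zero) + rest
    ≡⟨ +-assoc (b2n (f (suc a))) _ _ ⟩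
  b2n (f (suc a)) + (b2n (f zero) + rest) ∎
  where
  open ≡-Reasoning
  rest = countTrue (λ i → f (suc (punchIn a i)))

infixl 6 _∖_
_∖_ : ∀ {n} → (Fin n → Bool) → Fin n → (Fin n → Bool)
(f ∖ a) i = not (a == i) ∧ f i

count-∖ : ∀ {n} (f : Fin n → Bool) a → countTrue f ≡ b2n (f a) + countTrue (f ∖ a)
count-∖ {suc n} f zero    = refl
count-∖ {suc n} f (suc a) = begin
  b2n (f zero) + countTrue (f ∘ suc)
    ≡⟨ cong (b2n (f zero) +_) (count-∖ (f ∘ suc) a) ⟩
  b2n (f zero) + (b2n (f (suc a)) + rest)
    ≡⟨ sym (+-assoc (b2n (f zero)) _ _) ⟩
  b2n (f zero) + b2n (f (suc a)) + rest
    ≡⟨ cong (_+ rest) (+-comm (b2n (f zero)) _) ⟩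
  b2n (f (suc a)) + b2n (f zero) + rest
    ≡⟨ +-assoc (b2n (f (suc a))) _ _ ⟩
  b2n (f (suc a)) + (b2n (f zero) + rest) ∎
  where
  open ≡-Reasoning
  rest = countTrue ((f ∘ suc) ∖ a)

∖-intro : ∀ {n} (f : Fin n → Bool) {a i} → a ≢ i → f i ≡ true → (f ∖ a) i ≡ true
∖-intro f a≢i fi = ∧-intro (not-false (≢⇒== a≢i)) fi

∖-elim : ∀ {n} (f : Fin n → Bool) a i → (f ∖ a) i ≡ true → a ≢ i × f i ≡ true
∖-elim f a i e with ∧-true e
... | p , q = ==-false a i (not-true p) , q

count-∖-true : ∀ {n} (f : Fin n → Bool) a → f a ≡ true → countTrue f ≡ suc (countTrue (f ∖ a))
count-∖-true f a fa = trans (count-∖ f a) (cong (λ b → b2n b + countTrue (f ∖ a)) fa)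

count-∖-≤ : ∀ {n} (f : Fin n → Bool) a → countTrue f ≤ suc (countTrue (f ∖ a))
count-∖-≤ f a = subst (_≤ suc (countTrue (f ∖ a))) (sym (count-∖ f a)) (+-monoˡ-≤ (countTrue (f ∖ a)) (b2n≤1 (f a)))
  where
  b2n≤1 : ∀ b → b2n b ≤ 1
  b2n≤1 true  = ≤-refl
  b2n≤1 false = z≤n

count-pos : ∀ {n} (f : Fin n → Bool) → 0 < countTrue f → ∃ λ i → f i ≡ true
count-pos {suc n} f h with f zero in e
... | true  = zero , e
... | false with count-pos (f ∘ suc) h
...   | i , fi = suc i , fi

count-witness : ∀ {n} (f : Fin n → Bool) {a} → f a ≡ true → 0 < countTrue f
count-witness f {a} fa rewrite count-∖-true f a fa = s≤s z≤n

count≡0 : ∀ {n} (f : Fin n → Bool) → countTrue f ≡ 0 → ∀ i → f i ≡ false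
count≡0 f e i with f i in fi
... | false = refl
... | true  = ⊥-elim (<-irrefl (sym e) (count-witness f fi))

count≡1 : ∀ {n} (f : Fin n → Bool) → countTrue f ≡ 1 →
  ∃ λ i → f i ≡ true × (∀ j → f j ≡ true → i ≡ j)
count≡1 f e with count-pos f (subst (0 <_) (sym e) (s≤s z≤n))
... | i , fi = i , fi , only
  where
  only : ∀ j → f j ≡ true → i ≡ j
  only j fj with i ≟ j
  ... | yes p = p
  ... | no ¬p = ⊥-elim (true≢false (∖-intro f ¬p fj)
                  (count≡0 (f ∖ i) (suc-injective (trans (sym (count-∖-true f i fi)) e)) j))

count-unique : ∀ {n} (f : Fin n → Bool) {i} → f i ≡ true → (∀ j → f j ≡ true → i ≡ j) → countTrue f ≡ 1
count-unique f {i} fi only = trans (count-∖-true f i fi) (cong suc (none _ λ j e →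
  let p , q = ∖-elim f i j e in p (only j q)))
  where
  none : ∀ {n} (g : Fin n → Bool) → (∀ j → g j ≡ true → ⊥) → countTrue g ≡ 0
  none {zero}  g h = refl
  none {suc n} g h with g zero in e
  ... | true  = ⊥-elim (h zero e)
  ... | false = none (g ∘ suc) (h ∘ suc)

count-two : ∀ {n} (f : Fin n → Bool) {i j} → i ≢ j → f i ≡ true → f j ≡ true → 2 ≤ countTrue f
count-two f {i} {j} i≢j fi fj rewrite count-∖-true f i fi = s≤s (count-witness (f ∖ i) (∖-intro f i≢j fj))

-- Pigeonhole for a map defined only on the members of `f`. The image of the first member is deleted
-- from `g`, and injectivity keeps the other images clear of it.
count-inj : ∀ {n k} (f : Fin n → Bool) (g : Fin k → Bool) (h : ∀ i → f i ≡ true → Fin k) →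
  (∀ i p → g (h i p) ≡ true) → (∀ i j p q → h i p ≡ h j q → i ≡ j) → countTrue f ≤ countTrue g
count-inj {zero}  f g h hg inj = z≤n
count-inj {suc n} f g h hg inj with f zero in e
... | false = count-inj (f ∘ suc) g (h ∘ suc) (hg ∘ suc) λ i j p q r → Finₚ.suc-injective (inj (suc i) (suc j) p q r)
... | true rewrite count-∖-true g (h zero e) (hg zero e) =
  s≤s (count-inj (f ∘ suc) (g ∖ h zero e) (h ∘ suc)
    (λ i p → ∖-intro g (λ r → 0≢1+ (inj zero (suc i) e p r)) (hg (suc i) p))
    λ i j p q r → Finₚ.suc-injective (inj (suc i) (suc j) p q r))
  where
  0≢1+ : ∀ {n} {i : Fin n} → zero ≢ Fin.suc i
  0≢1+ ()

-- The forbidden values are given by a partial function, so that partners in a partial matching can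
-- be listed without knowing whether they exist.
count-avoid : ∀ {n k} (f : Fin n → Bool) (bad : Fin k → Maybe (Fin n)) → k < countTrue f →
  ∃ λ v → f v ≡ true × (∀ i → bad i ≢ just v)
count-avoid {k = zero}  f bad h with count-pos f h
... | v , fv = v , fv , λ ()
count-avoid {k = suc k} f bad h with bad zero in e
... | nothing with count-avoid f (bad ∘ suc) (≤-trans (n≤1+n _) h)
...   | v , fv , ok = v , fv , λ { zero r → case-nothing (trans (sym e) r) ; (suc i) → ok i }
  where
  case-nothing : ∀ {v} → nothing ≡ just v → ⊥
  case-nothing ()
count-avoid {k = suc k} f bad h | just w
  with count-avoid (f ∖ w) (bad ∘ suc) (≤-pred (≤-trans h (count-∖-≤ f w)))
... | v , fv , ok = v , proj₂ (∖-elim f w v fv) ,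
      λ { zero r → proj₁ (∖-elim f w v fv) (just-inj (trans (sym e) r)) ; (suc i) → ok i }
  where
  just-inj : ∀ {A : Set} {x y : A} → just x ≡ just y → x ≡ y
  just-inj refl = refl

-- A greedy system of distinct representatives: each set is at least as large as the number of sets,
-- so the values taken by the other indices never exhaust it and no Hall-type condition arises.
distinct-reps : ∀ {n k} (live : Fin k → Bool) (S : Fin k → Fin n → Bool) →
  (∀ q → live q ≡ true → k ≤ countTrue (S q)) →
  Σ (Fin k → Maybe (Fin n)) λ t →
    (∀ q → live q ≡ true → ∃ λ v → t q ≡ just v) ×
    (∀ q v → t q ≡ just v → S q v ≡ true) ×
    (∀ q q′ v → t q ≡ just v → t q′ ≡ just v → q ≡ q′)
distinct-reps {k = zero} live S big = (λ ()) , (λ ()) , (λ ()) , (λ ())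
distinct-reps {n} {suc k} live S big
  with distinct-reps (live ∘ suc) (S ∘ suc) (λ q l → ≤-trans (n≤1+n k) (big (suc q) l))
... | t , ex , mem , inj with live zero in e
...   | false = t₀ , ex₀ , mem₀ , inj₀
  where
  t₀ : Fin (suc k) → Maybe (Fin n)
  t₀ zero    = nothing
  t₀ (suc q) = t q
  ex₀ : ∀ q → live q ≡ true → ∃ λ v → t₀ q ≡ just v
  ex₀ zero    l = ⊥-elim (true≢false l e)
  ex₀ (suc q) l = ex q l
  mem₀ : ∀ q v → t₀ q ≡ just v → S q v ≡ true
  mem₀ (suc q) = mem q
  inj₀ : ∀ q q′ v → t₀ q ≡ just v → t₀ q′ ≡ just v → q ≡ q′
  inj₀ (suc q) (suc q′) v r s = cong suc (inj q q′ v r s)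
...   | true with count-avoid (S zero) t (big zero e)
...     | w , Sw , new = t₀ , ex₀ , mem₀ , inj₀
  where
  t₀ : Fin (suc k) → Maybe (Fin n)
  t₀ zero    = just w
  t₀ (suc q) = t q
  ex₀ : ∀ q → live q ≡ true → ∃ λ v → t₀ q ≡ just v
  ex₀ zero    l = w , refl
  ex₀ (suc q) l = ex q l
  mem₀ : ∀ q v → t₀ q ≡ just v → S q v ≡ true
  mem₀ zero    v refl = Sw
  mem₀ (suc q) v r    = mem q v r
  inj₀ : ∀ q q′ v → t₀ q ≡ just v → t₀ q′ ≡ just v → q ≡ q′
  inj₀ zero    zero     v r    s    = refl
  inj₀ zero    (suc q′) v refl s    = ⊥-elim (new q′ s)
  inj₀ (suc q) zero     v r    refl = ⊥-elim (new q r)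
  inj₀ (suc q) (suc q′) v r    s    = cong suc (inj q q′ v r s)

-- Finite sums and labellings with prescribed counts

∑ : ∀ {n} → (Fin n → ℕ) → ℕ
∑ {zero}  f = 0
∑ {suc n} f = f zero + ∑ (f ∘ suc)

∑-cong : ∀ {n} {f g : Fin n → ℕ} → (∀ i → f i ≡ g i) → ∑ f ≡ ∑ g
∑-cong {zero}  h = refl
∑-cong {suc n} h = cong₂ _+_ (h zero) (∑-cong (h ∘ suc))

∑-mono : ∀ {n} {f g : Fin n → ℕ} → (∀ i → f i ≤ g i) → ∑ f ≤ ∑ g
∑-mono {zero}  h = z≤n
∑-mono {suc n} h = +-mono-≤ (h zero) (∑-mono (h ∘ suc))

∑-mono-< : ∀ {n} {f g : Fin n → ℕ} → (∀ i → f i ≤ g i) → ∀ j → f j < g j → ∑ f < ∑ g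
∑-mono-< h zero    l = +-mono-<-≤ l (∑-mono (h ∘ suc))
∑-mono-< h (suc j) l = +-mono-≤-< (h zero) (∑-mono-< (h ∘ suc) j l)

∑-bound : ∀ {n} (f : Fin n → ℕ) b → (∀ i → f i ≤ b) → ∑ f ≤ n * b
∑-bound {zero}  f b h = z≤n
∑-bound {suc n} f b h = +-mono-≤ (h zero) (∑-bound (f ∘ suc) b (h ∘ suc))

∑-zero : ∀ {n} {f : Fin n → ℕ} → (∀ i → f i ≡ 0) → ∑ f ≡ 0
∑-zero {zero}  h = refl
∑-zero {suc n} h = cong₂ _+_ (h zero) (∑-zero (h ∘ suc))

∑-+ : ∀ {n} (f g : Fin n → ℕ) → ∑ (λ i → f i + g i) ≡ ∑ f + ∑ g
∑-+ {zero}  f g = refl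
∑-+ {suc n} f g = begin
  f zero + g zero + ∑ (λ i → f (suc i) + g (suc i)) ≡⟨ cong (f zero + g zero +_) (∑-+ (f ∘ suc) (g ∘ suc)) ⟩
  f zero + g zero + (F + G)   ≡⟨ +-assoc (f zero) _ _ ⟩
  f zero + (g zero + (F + G)) ≡⟨ cong (f zero +_) (sym (+-assoc (g zero) F G)) ⟩
  f zero + (g zero + F + G)   ≡⟨ cong (λ z → f zero + (z + G)) (+-comm (g zero) F) ⟩
  f zero + (F + g zero + G)   ≡⟨ cong (f zero +_) (+-assoc F (g zero) G) ⟩
  f zero + (F + (g zero + G)) ≡⟨ sym (+-assoc (f zero) F _) ⟩
  f zero + F + (g zero + G) ∎
  where
  open ≡-Reasoning
  F = ∑ (f ∘ suc)
  G = ∑ (g ∘ suc)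

∑-pos : ∀ {n} (f : Fin n → ℕ) → 0 < ∑ f → ∃ λ i → 0 < f i
∑-pos {suc n} f h with f zero in e
... | suc _ = zero , subst (0 <_) (sym e) (s≤s z≤n)
... | zero with ∑-pos (f ∘ suc) h
...   | i , p = suc i , p

∑-δ : ∀ {n} (j : Fin n) (h : Fin n → ℕ) → ∑ (λ i → if j == i then h i else 0) ≡ h j
∑-δ {suc n} zero h = trans (cong (h zero +_) (∑-zero {n} λ i → refl)) (+-identityʳ _)
∑-δ (suc j) h = ∑-δ j (h ∘ suc)

cnt-label : ∀ {n k} → (Fin n → Fin k) → Fin k → ℕ
cnt-label ℓ z = countTrue (λ v → ℓ v == z)

sumWhere : ∀ {k} → (Fin k → Bool) → (Fin k → ℕ) → ℕ
sumWhere g y = ∑ (λ z → if g z then y z else 0)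

if-+ : ∀ b x y → (if b then x + y else 0) ≡ (if b then x else 0) + (if b then y else 0)
if-+ true  x y = refl
if-+ false x y = refl

sumWhere-cong : ∀ {k} (g : Fin k → Bool) {x y : Fin k → ℕ} → (∀ z → x z ≡ y z) → sumWhere g x ≡ sumWhere g y
sumWhere-cong g h = ∑-cong λ z → cong (λ t → if g z then t else 0) (h z)

sumWhere-+ : ∀ {k} (g : Fin k → Bool) (x y : Fin k → ℕ) →
  sumWhere g (λ z → x z + y z) ≡ sumWhere g x + sumWhere g y
sumWhere-+ g x y = trans (∑-cong λ z → if-+ (g z) (x z) (y z))
  (∑-+ (λ z → if g z then x z else 0) (λ z → if g z then y z else 0))

sumWhere-δ : ∀ {k} (g : Fin k → Bool) j → sumWhere g (λ z → b2n (j == z)) ≡ b2n (g j)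
sumWhere-δ g j = trans (∑-cong λ z → swap (g z) (j == z)) (∑-δ j (b2n ∘ g))
  where
  swap : ∀ a b → (if a then b2n b else 0) ≡ (if b then b2n a else 0)
  swap true  true  = refl
  swap true  false = refl
  swap false true  = refl
  swap false false = refl

count-label : ∀ {n k} (g : Fin k → Bool) (ℓ : Fin n → Fin k) →
  countTrue (λ v → g (ℓ v)) ≡ sumWhere g (cnt-label ℓ)
count-label {zero}  g ℓ = sym (∑-zero λ z → if-0 (g z))
  where
  if-0 : ∀ b → (if b then 0 else 0) ≡ 0
  if-0 true  = refl
  if-0 false = refl
count-label {suc n} g ℓ = begin
  b2n (g (ℓ zero)) + countTrue (λ v → g (ℓ (suc v)))
    ≡⟨ cong₂ _+_ (sym (sumWhere-δ g (ℓ zero))) (count-label g (ℓ ∘ suc)) ⟩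
  sumWhere g (λ z → b2n (ℓ zero == z)) + sumWhere g (cnt-label (ℓ ∘ suc))
    ≡⟨ sym (sumWhere-+ g (λ z → b2n (ℓ zero == z)) (cnt-label (ℓ ∘ suc))) ⟩
  sumWhere g (cnt-label ℓ) ∎
  where open ≡-Reasoning

sumWhere-pos : ∀ {k} (g : Fin k → Bool) (y : Fin k → ℕ) → 0 < sumWhere g y →
  ∃ λ z → g z ≡ true × 0 < y z
sumWhere-pos g y h with ∑-pos (λ z → if g z then y z else 0) h
... | z , p = z , go (g z) refl p
  where
  go : ∀ b → g z ≡ b → 0 < (if b then y z else 0) → g z ≡ true × 0 < y z
  go true  e p = e , p

-- Turns numbers into an actual refinement of a labelling. The first vertex takes any `z` above its
-- label with `y z` positive, which exists because that label occurs; `y z` is then lowered by one.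
lift-labels : ∀ {n k q} (f : Fin k → Fin q) (lab : Fin n → Fin q) (y : Fin k → ℕ) →
  (∀ i → cnt-label lab i ≡ sumWhere (λ z → f z == i) y) →
  Σ (Fin n → Fin k) λ ℓ → (∀ v → f (ℓ v) ≡ lab v) × (∀ z → cnt-label ℓ z ≡ y z)
lift-labels {zero} f lab y h = (λ ()) , (λ ()) , λ z → sym (n≤0⇒n≡0 (≮⇒≥ (pos z)))
  where
  pos : ∀ z → ¬ (0 < y z)
  pos z p = <-irrefl (h (f z)) (≤-trans p (≤-trans (≤-reflexive eqz) (term z)))
    where
    g = λ w → if f w == f z then y w else 0
    eqz : y z ≡ g z
    eqz rewrite ==-refl (f z) = refl
    term : ∀ z → g z ≤ ∑ g
    term = go g
      where
      go : ∀ {n} (g : Fin n → ℕ) z → g z ≤ ∑ g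
      go g zero    = m≤m+n _ _
      go g (suc z) = ≤-trans (go (g ∘ suc) z) (m≤n+m _ _)
lift-labels {suc n} {k} f lab y h
  with sumWhere-pos (λ z → f z == lab zero) y
         (subst (0 <_) (h (lab zero)) (count-witness (λ v → lab v == lab zero) {zero} (==-refl (lab zero))))
... | z₀ , fz₀ , pz₀ = ℓ , fℓ , cntℓ
  where
  y′ : Fin k → ℕ
  y′ z = if z₀ == z then y z ∸ 1 else y z
  y-split : ∀ z → y z ≡ b2n (z₀ == z) + y′ z
  y-split z with z₀ ≟ z
  ... | yes refl = sym (m+[n∸m]≡n pz₀)
  ... | no _     = refl
  h′ : ∀ i → cnt-label (lab ∘ suc) i ≡ sumWhere (λ z → f z == i) y′
  h′ i = +-cancelˡ-≡ (b2n (lab zero == i)) _ _ (begin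
    b2n (lab zero == i) + cnt-label (lab ∘ suc) i ≡⟨ h i ⟩
    sumWhere G y                                  ≡⟨ sumWhere-cong G y-split ⟩
    sumWhere G (λ z → b2n (z₀ == z) + y′ z)       ≡⟨ sumWhere-+ G (λ z → b2n (z₀ == z)) y′ ⟩
    sumWhere G (λ z → b2n (z₀ == z)) + sumWhere G y′ ≡⟨ cong (_+ sumWhere G y′) (sumWhere-δ G z₀) ⟩
    b2n (f z₀ == i) + sumWhere G y′               ≡⟨ cong (λ t → b2n (t == i) + sumWhere G y′) (==⇒≡ (f z₀) (lab zero) fz₀) ⟩
    b2n (lab zero == i) + sumWhere G y′ ∎)
    where
    open ≡-Reasoning
    G = λ z → f z == i
  rec = lift-labels f (lab ∘ suc) y′ h′
  ℓ : Fin (suc n) → Fin k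
  ℓ zero    = z₀
  ℓ (suc v) = proj₁ rec v
  fℓ : ∀ v → f (ℓ v) ≡ lab v
  fℓ zero    = ==⇒≡ (f z₀) (lab zero) fz₀
  fℓ (suc v) = proj₁ (proj₂ rec) v
  cntℓ : ∀ z → cnt-label ℓ z ≡ y z
  cntℓ z = trans (cong (b2n (z₀ == z) +_) (proj₂ (proj₂ rec) z)) (sym (y-split z))

labels-with-counts : ∀ {k} (y : Fin k → ℕ) → Σ (Fin (∑ y) → Fin k) λ ℓ → ∀ z → cnt-label ℓ z ≡ y z
labels-with-counts y with lift-labels {q = 1} (λ _ → zero) (λ _ → zero) y (λ { zero → count-true _ })
... | ℓ , _ , h = ℓ , h

∑-cnt-label : ∀ {n k} (ℓ : Fin n → Fin k) → ∑ (cnt-label ℓ) ≡ n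
∑-cnt-label {n} ℓ = trans (sym (count-label (λ _ → true) ℓ)) (count-true n)

enumerate : ∀ {n} s (f : Fin n → Bool) → s ≤ countTrue f →
  Σ (Fin s → Fin n) λ e → (∀ i → f (e i) ≡ true) × (∀ i j → e i ≡ e j → i ≡ j)
enumerate zero    f h = (λ ()) , (λ ()) , λ ()
enumerate {n} (suc s) f h with count-pos f (≤-trans (s≤s z≤n) h)
... | v , fv with enumerate s (f ∖ v) (≤-pred (subst (suc s ≤_) (count-∖-true f v fv) h))
...   | e , fe , inj = e₀ , fe₀ , inj₀
  where
  e₀ : Fin (suc s) → Fin n
  e₀ zero    = v
  e₀ (suc i) = e i
  fe₀ : ∀ i → f (e₀ i) ≡ true
  fe₀ zero    = fv
  fe₀ (suc i) = proj₂ (∖-elim f v (e i) (fe i))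
  inj₀ : ∀ i j → e₀ i ≡ e₀ j → i ≡ j
  inj₀ zero    zero    r = refl
  inj₀ zero    (suc j) r = ⊥-elim (proj₁ (∖-elim f v (e j) (fe j)) r)
  inj₀ (suc i) zero    r = ⊥-elim (proj₁ (∖-elim f v (e i) (fe i)) (sym r))
  inj₀ (suc i) (suc j) r = cong suc (inj i j r)

rank : ∀ {n} → (Fin n → Bool) → Fin n → ℕ
rank f zero    = 0
rank f (suc i) = b2n (f zero) + rank (f ∘ suc) i

rank<count : ∀ {n} (f : Fin n → Bool) i → f i ≡ true → rank f i < countTrue f
rank<count f zero    e rewrite e = s≤s z≤n
rank<count f (suc i) e = subst (_≤ b2n (f zero) + countTrue (f ∘ suc)) (+-suc (b2n (f zero)) _)
  (+-monoʳ-≤ (b2n (f zero)) (rank<count (f ∘ suc) i e))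

rank-injective : ∀ {n} (f : Fin n → Bool) i j → f i ≡ true → f j ≡ true → rank f i ≡ rank f j → i ≡ j
rank-injective f zero    zero    p q e = refl
rank-injective f zero    (suc j) p q e rewrite p with () ← e
rank-injective f (suc i) zero    p q e rewrite q with () ← e
rank-injective f (suc i) (suc j) p q e =
  cong suc (rank-injective (f ∘ suc) i j p q (+-cancelˡ-≡ (b2n (f zero)) _ _ e))

-- The ranks of the members run through 0, 1, 2, ... without gaps, so the members of rank below `K`
-- are the first `K` of them.
count-rank : ∀ {n} (f : Fin n → Bool) K → K ≤ countTrue f →
  K ≤ countTrue (λ i → f i ∧ (rank f i <ᵇ K))
count-rank {n} f zero h = z≤n
count-rank {suc n} f (suc K) h with f zero in e
... | true  = s≤s (count-rank (f ∘ suc) K (≤-pred h))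
... | false = count-rank (f ∘ suc) (suc K) h

-- Presburger definability

module _ {M : ℕ} {E : Set} (e : E → Vec ℕ M) where

  -- States `ε` are read as valuations through `e`. Formulas can thus be specified by predicates on
  -- states, and variable indices are handled only where `e` is extended.
  record TermFor (f : E → ℕ) : Set where
    field
      term    : PTerm M
      correct : ∀ ε → evalT term (e ε) ≡ f ε

  record Defn (Q : E → Set) : Set where
    field
      form     : PForm M
      sound    : ∀ ε → PSat form (e ε) → Q ε
      complete : ∀ ε → Q ε → PSat form (e ε)

  -- Decidability is recorded separately from definability because it is lost under existential
  -- quantification. After that point only conjunction is used.
  record DecDefn (Q : E → Set) : Set where
    field
      defn   : Defn Q
      decide : ∀ ε → Dec (Q ε)

open TermFor
open Defn
open DecDefn

module _ {M : ℕ} {E : Set} {e : E → Vec ℕ M} where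

  infixr 2 _×D_ _∩_
  infixr 1 _⊎D_
  infix 4 _≡D_ _≤D_
  infixl 6 _+T_

  constT : ∀ k → TermFor e (λ _ → k)
  constT zero    = record { term = zer ; correct = λ _ → refl }
  constT (suc k) = record { term = plus one (term (constT k)) ; correct = λ ε → cong suc (correct (constT k) ε) }

  _+T_ : ∀ {f g} → TermFor e f → TermFor e g → TermFor e (λ ε → f ε + g ε)
  s +T t = record { term = plus (term s) (term t) ; correct = λ ε → cong₂ _+_ (correct s ε) (correct t ε) }

  ∑T : ∀ {k} {f : Fin k → E → ℕ} → (∀ i → TermFor e (f i)) → TermFor e (λ ε → ∑ (λ i → f i ε))
  ∑T {zero}  t = constT 0
  ∑T {suc k} t = t zero +T ∑T (t ∘ suc)

  ifT : ∀ b {f g : E → ℕ} → TermFor e f → TermFor e g → TermFor e (λ ε → if b then f ε else g ε)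
  ifT true  s t = s
  ifT false s t = t

  sumWhereT : ∀ {k} (g : Fin k → Bool) {f : Fin k → E → ℕ} → (∀ i → TermFor e (f i)) →
    TermFor e (λ ε → sumWhere g (λ i → f i ε))
  sumWhereT g t = ∑T (λ i → ifT (g i) (t i) (constT 0))

  _≡D_ : ∀ {f g} → TermFor e f → TermFor e g → DecDefn e (λ ε → f ε ≡ g ε)
  _≡D_ {f} {g} s t = record
    { defn = record
      { form     = peq (term s) (term t)
      ; sound    = λ ε p → trans (sym (correct s ε)) (trans p (correct t ε))
      ; complete = λ ε p → trans (correct s ε) (trans p (sym (correct t ε))) }
    ; decide = λ ε → f ε ℕₚ.≟ g ε }

  _≤D_ : ∀ {f g} → TermFor e f → TermFor e g → DecDefn e (λ ε → f ε ≤ g ε)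
  _≤D_ {f} {g} s t = record
    { defn = record
      { form     = ple (term s) (term t)
      ; sound    = λ ε p → subst₂ _≤_ (correct s ε) (correct t ε) p
      ; complete = λ ε p → subst₂ _≤_ (sym (correct s ε)) (sym (correct t ε)) p }
    ; decide = λ ε → f ε ≤? g ε }

  -- Conditions on palettes and colours alone are settled while the formula is being constructed,
  -- leaving a trivially true or false atom.
  static : {A : Set} → Dec A → DecDefn e (λ _ → A)
  static (yes a) = record
    { defn   = record { form = peq zer zer ; sound = λ _ _ → a ; complete = λ _ _ → refl }
    ; decide = λ _ → yes a }
  static (no ¬a) = record
    { defn   = record { form = peq zer one ; sound = λ _ () ; complete = λ _ a → ⊥-elim (¬a a) }
    ; decide = λ _ → no ¬a }

  _∩_ : ∀ {Q R : E → Set} → Defn e Q → Defn e R → Defn e (λ ε → Q ε × R ε)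
  d ∩ d′ = record
    { form     = pand (form d) (form d′)
    ; sound    = λ ε (p , q) → sound d ε p , sound d′ ε q
    ; complete = λ ε (p , q) → complete d ε p , complete d′ ε q }

  _×D_ : ∀ {Q R : E → Set} → DecDefn e Q → DecDefn e R → DecDefn e (λ ε → Q ε × R ε)
  d ×D d′ = record { defn = defn d ∩ defn d′ ; decide = λ ε → decide d ε ×-dec decide d′ ε }

  -- PForm has no disjunction; decidability makes its De Morgan encoding constructively correct.
  _⊎D_ : ∀ {Q R : E → Set} → DecDefn e Q → DecDefn e R → DecDefn e (λ ε → Q ε ⊎ R ε)
  _⊎D_ {Q} {R} d d′ = record
    { defn = record
      { form     = pneg (pand (pneg (form (defn d))) (pneg (form (defn d′))))
      ; sound    = snd
      ; complete = λ { ε (inj₁ q) (p , _) → p (complete (defn d) ε q)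
                     ; ε (inj₂ r) (_ , p) → p (complete (defn d′) ε r) } }
    ; decide = λ ε → decide d ε ⊎-dec decide d′ ε }
    where
    snd : ∀ ε → ¬ (¬ PSat (form (defn d)) (e ε) × ¬ PSat (form (defn d′)) (e ε)) → Q ε ⊎ R ε
    snd ε h with decide d ε | decide d′ ε
    ... | yes q | _     = inj₁ q
    ... | no _  | yes r = inj₂ r
    ... | no ¬q | no ¬r = ⊥-elim (h ((λ p → ¬q (sound (defn d) ε p)) , λ p → ¬r (sound (defn d′) ε p)))

  mapD : ∀ {Q R : E → Set} → (∀ ε → Q ε → R ε) → (∀ ε → R ε → Q ε) → DecDefn e Q → DecDefn e R
  mapD to from d = record
    { defn = record
      { form     = form (defn d)
      ; sound    = λ ε p → to ε (sound (defn d) ε p)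
      ; complete = λ ε r → complete (defn d) ε (from ε r) }
    ; decide = λ ε → map′ (to ε) (from ε) (decide d ε) }

  -- A finite conjunction over an index set fixed in advance, as `∃D` is a finite disjunction;
  -- genuine Presburger quantifiers enter only through `ΣD`.
  ∀D : ∀ {k} {Q : Fin k → E → Set} → (∀ i → DecDefn e (Q i)) → DecDefn e (λ ε → ∀ i → Q i ε)
  ∀D {zero}  d = mapD (λ _ _ ()) (λ _ _ → refl) (static {0 ≡ 0} (yes refl))
  ∀D {suc k} d = mapD (λ { ε (p , q) zero → p ; ε (p , q) (suc i) → q i }) (λ ε p → p zero , p ∘ suc)
                   (d zero ×D ∀D (d ∘ suc))

  ∃D : ∀ {k} {Q : Fin k → E → Set} → (∀ i → DecDefn e (Q i)) → DecDefn e (λ ε → ∃ λ i → Q i ε)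
  ∃D {zero}  d = mapD (λ _ ()) (λ _ ()) (static {⊥} (no λ ()))
  ∃D {suc k} d = mapD (λ { ε (inj₁ p) → zero , p ; ε (inj₂ (i , q)) → suc i , q })
                      (λ { ε (zero , p) → inj₁ p ; ε (suc i , p) → inj₂ (i , p) })
                   (d zero ⊎D ∃D (d ∘ suc))


-- Blocks of existential quantifiers

extendEnv : ∀ {M k} {E : Set} → (E → Vec ℕ M) → Vec ℕ k × E → Vec ℕ (k + M)
extendEnv e (xs , ε) = xs ++ e ε

weakenTerm : ∀ k {M} → PTerm M → PTerm (k + M)
weakenTerm k (var i)    = var (k ↑ʳ i)
weakenTerm k zer        = zer
weakenTerm k one        = one
weakenTerm k (plus t u) = plus (weakenTerm k t) (weakenTerm k u)

evalT-weaken : ∀ {k M} (t : PTerm M) (xs : Vec ℕ k) ρ → evalT (weakenTerm k t) (xs ++ ρ) ≡ evalT t ρ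
evalT-weaken (var i)    xs ρ = lookup-++ʳ xs ρ i
evalT-weaken zer        xs ρ = refl
evalT-weaken one        xs ρ = refl
evalT-weaken (plus t u) xs ρ = cong₂ _+_ (evalT-weaken t xs ρ) (evalT-weaken u xs ρ)

weakenT : ∀ {M k} {E : Set} {e : E → Vec ℕ M} {f} → TermFor e f → TermFor (extendEnv {k = k} e) (λ (xs , ε) → f ε)
weakenT {k = k} {e = e} t = record
  { term    = weakenTerm k (term t)
  ; correct = λ (xs , ε) → trans (evalT-weaken (term t) xs (e ε)) (correct t ε) }

newVarT : ∀ {M k} {E : Set} {e : E → Vec ℕ M} (i : Fin k) → TermFor (extendEnv {k = k} e) (λ (xs , ε) → lookup xs i)
newVarT {M} {e = e} i = record
  { term    = var (i ↑ˡ M)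
  ; correct = λ (xs , ε) → lookup-++ˡ xs (e ε) i }

pexs : ∀ k {M} → PForm (k + M) → PForm M
pexs zero    φ = φ
pexs (suc k) φ = pexs k (pex φ)

pexs-sound : ∀ k {M} (φ : PForm (k + M)) ρ → PSat (pexs k φ) ρ → Σ (Vec ℕ k) λ xs → PSat φ (xs ++ ρ)
pexs-sound zero    φ ρ p = [] , p
pexs-sound (suc k) φ ρ p with pexs-sound k (pex φ) ρ p
... | xs , x , q = x ∷ xs , q

pexs-complete : ∀ k {M} (φ : PForm (k + M)) ρ xs → PSat φ (xs ++ ρ) → PSat (pexs k φ) ρ
pexs-complete zero    φ ρ []       p = p
pexs-complete (suc k) φ ρ (x ∷ xs) p = pexs-complete k (pex φ) ρ xs (x , p)

ΣD : ∀ {M k} {E : Set} {e : E → Vec ℕ M} {Q : Vec ℕ k → E → Set} →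
  Defn (extendEnv e) (λ (xs , ε) → Q xs ε) → Defn e (λ ε → Σ (Vec ℕ k) λ xs → Q xs ε)
ΣD {k = k} {e = e} d = record
  { form     = pexs k (form d)
  ; sound    = λ ε p → let xs , q = pexs-sound k (form d) (e ε) p in xs , sound d (xs , ε) q
  ; complete = λ ε (xs , q) → pexs-complete k (form d) (e ε) xs (complete d (xs , ε) q) }

just≢nothing : ∀ {A : Set} {x : Maybe A} {y} → x ≡ just y → x ≡ nothing → ⊥
just≢nothing refl ()

does-true : ∀ {A : Set} (d : Dec A) → does d ≡ true → A
does-true (yes a) _ = a

module _ {n m : ℕ} {A : Set} where

  set : (Fin n → Fin m → A) → Fin n → Fin m → A → Fin n → Fin m → A
  set f a c x v d = if (a == v) ∧ (c == d) then x else f v d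

  set-same : ∀ f a c x → set f a c x a c ≡ x
  set-same f a c x rewrite ==-refl a | ==-refl c = refl

  set-other : ∀ f a c x {v d} → ¬ (a ≡ v × c ≡ d) → set f a c x v d ≡ f v d
  set-other f a c x {v} {d} h with a ≟ v | c ≟ d
  ... | no _  | _     = refl
  ... | yes _ | no _  = refl
  ... | yes p | yes q = ⊥-elim (h (p , q))

same? : ∀ {n m} (a v : Fin n) (c d : Fin m) → Dec (a ≡ v × c ≡ d)
same? a v c d = (a ≟ v) ×-dec (c ≟ d)

-- Colourings with prescribed palettes

module Palettes
  (m : ℕ) (c₀ : Fin m) (rev : Fin m → Fin m)
  (rev-rev : ∀ c → rev (rev c) ≡ c) (rev≢ : ∀ c → rev c ≢ c)
  (uniq : Fin m → Bool)
  (P : ℕ) (mem : Fin P → Fin m → Bool)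
  where

  rev-inj : ∀ {c d} → rev c ≡ rev d → c ≡ d
  rev-inj {c} {d} r = trans (sym (rev-rev c)) (trans (cong rev r) (rev-rev d))

  -- All conditions concern distinct vertices, so the value of `χ` on the diagonal is arbitrary.
  record Colouring {n : ℕ} (lab : Fin n → Fin P) : Set where
    field
      χ        : Fin n → Fin n → Fin m
      χ-sym    : ∀ {a b} → a ≢ b → χ b a ≡ rev (χ a b)
      χ-mem    : ∀ {a b} → a ≢ b → mem (lab a) (χ a b) ≡ true
      χ-exists : ∀ {a c} → uniq c ≡ true → mem (lab a) c ≡ true → ∃ λ b → a ≢ b × χ a b ≡ c
      χ-unique : ∀ {a b b′} → a ≢ b → a ≢ b′ → uniq (χ a b) ≡ true → χ a b ≡ χ a b′ → b ≡ b′

  Compat : Fin P → Fin P → Set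
  Compat p q = ∃ λ c → uniq c ≡ false × uniq (rev c) ≡ false × mem p c ≡ true × mem q (rev c) ≡ true

  deg : ∀ {n} → (Fin n → Fin P) → Fin m → ℕ
  deg lab c = countTrue (λ v → mem (lab v) c)

  -- For each of the `m` colours there are three levels of `suc m` targets. A vertex has at most one
  -- matching partner per colour, so among `suc m` targets at least one is not yet joined to it.
  blocks : ℕ
  blocks = m * (3 * suc m)

  -- A swap has to avoid 2 + (m + m) vertices; the target blocks need one vertex for each of their slots.
  threshold : ℕ
  threshold = 2 + (m + m) + blocks

  module Realise {n : ℕ} (lab : Fin n → Fin P)
    (compat : ∀ v w → v ≢ w → Compat (lab v) (lab w))
    (large : ∀ c → uniq c ≡ true → 0 < deg lab c →
      threshold < deg lab (rev c) × (uniq (rev c) ≡ true → deg lab c ≡ deg lab (rev c)))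
    where

    V = Fin n

    -- Edge-disjoint matchings for the colours unique at both ends

    Partner : Set
    Partner = V → Fin m → Maybe V

    Matched : Partner → V → Fin m → Set
    Matched π v d = ∃ λ w → π v d ≡ just w

    -- All colours are matched simultaneously; `disj` is what keeps a pair of vertices from
    -- receiving two colours.
    record Valid (π : Partner) : Set where
      field
        dom  : ∀ {a c b} → π a c ≡ just b → uniq c ≡ true × uniq (rev c) ≡ true × mem (lab a) c ≡ true
        psym : ∀ {a c b} → π a c ≡ just b → π b (rev c) ≡ just a
        irr  : ∀ {a c b} → π a c ≡ just b → a ≢ b
        disj : ∀ {a c d b} → π a c ≡ just b → π a d ≡ just b → c ≡ d
    open Valid

    psym⁻ : ∀ {π} → Valid π → ∀ {a c b} → π b (rev c) ≡ just a → π a c ≡ just b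
    psym⁻ {π} val {a} {c} {b} e = subst (λ d → π a d ≡ just b) (rev-rev c) (psym val e)

    module Add {π : Partner} (val : Valid π) (a : V) (c : Fin m) (b : V)
      (a≢b : a ≢ b) (ac : π a c ≡ nothing) (bc : π b (rev c) ≡ nothing)
      (free : ∀ d → π a d ≢ just b)
      (u : uniq c ≡ true) (u′ : uniq (rev c) ≡ true)
      (ma : mem (lab a) c ≡ true) (mb : mem (lab b) (rev c) ≡ true) where

      new : Partner
      new = set (set π a c (just b)) b (rev c) (just a)

      new-b : new b (rev c) ≡ just a
      new-b = set-same (set π a c (just b)) b (rev c) (just a)

      new-a : new a c ≡ just b
      new-a = trans (set-other (set π a c (just b)) b (rev c) (just a) λ (p , _) → a≢b (sym p))
                    (set-same π a c (just b))

      new-other : ∀ {v d} → ¬ (a ≡ v × c ≡ d) → ¬ (b ≡ v × rev c ≡ d) → new v d ≡ π v d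
      new-other h₁ h₂ = trans (set-other (set π a c (just b)) b (rev c) (just a) h₂) (set-other π a c (just b) h₁)

      old : ∀ {v d w} → π v d ≡ just w → new v d ≡ just w
      old e = trans (new-other (λ { (refl , refl) → just≢nothing e ac }) (λ { (refl , refl) → just≢nothing e bc })) e

      data New (v : V) (d : Fin m) (w : V) : Set where
        isA : a ≡ v → c ≡ d → b ≡ w → New v d w
        isB : b ≡ v → rev c ≡ d → a ≡ w → New v d w
        isO : π v d ≡ just w → New v d w

      inv : ∀ {v d w} → new v d ≡ just w → New v d w
      inv {v} {d} {w} e with same? a v c d | same? b v (rev c) d
      ... | yes (refl , refl) | _ = isA refl refl (just-injective (trans (sym new-a) e))
      ... | no _ | yes (refl , refl) = isB refl refl (just-injective (trans (sym new-b) e))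
      ... | no h₁ | no h₂ = isO (trans (sym (new-other h₁ h₂)) e)

      valid : Valid new
      dom valid e with inv e
      ... | isA refl refl refl = u , u′ , ma
      ... | isB refl refl refl = u′ , trans (cong uniq (rev-rev c)) u , mb
      ... | isO o = dom val o
      psym valid e with inv e
      ... | isA refl refl refl = new-b
      ... | isB refl refl refl = subst (λ d → new a d ≡ just b) (sym (rev-rev c)) new-a
      ... | isO o = old (psym val o)
      irr valid e with inv e
      ... | isA refl refl refl = a≢b
      ... | isB refl refl refl = a≢b ∘ sym
      ... | isO o = irr val o
      disj valid e e′ with inv e | inv e′
      ... | isA refl refl refl | isA _ refl _ = refl
      ... | isA refl refl refl | isB p _ _ = ⊥-elim (a≢b (sym p))
      ... | isA refl refl refl | isO o = ⊥-elim (free _ o)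
      ... | isB refl refl refl | isA p _ _ = ⊥-elim (a≢b p)
      ... | isB refl refl refl | isB _ refl _ = refl
      ... | isB refl refl refl | isO o = ⊥-elim (free _ (psym val o))
      ... | isO o | isA refl refl refl = ⊥-elim (free _ o)
      ... | isO o | isB refl refl refl = ⊥-elim (free _ (psym val o))
      ... | isO o | isO o′ = disj val o o′

      keeps : ∀ {v d} → Matched π v d → Matched new v d
      keeps (w , e) = w , old e

    module Delete {π : Partner} (val : Valid π) (a : V) (c : Fin m) (b : V) (ab : π a c ≡ just b) where

      new : Partner
      new = set (set π a c nothing) b (rev c) nothing

      new-other : ∀ {v d} → ¬ (a ≡ v × c ≡ d) → ¬ (b ≡ v × rev c ≡ d) → new v d ≡ π v d
      new-other h₁ h₂ = trans (set-other (set π a c nothing) b (rev c) nothing h₂) (set-other π a c nothing h₁)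

      new-b : new b (rev c) ≡ nothing
      new-b = set-same (set π a c nothing) b (rev c) nothing

      new-a : new a c ≡ nothing
      new-a = trans (set-other (set π a c nothing) b (rev c) nothing λ (p , _) → irr val ab (sym p))
                    (set-same π a c nothing)

      inv : ∀ {v d w} → new v d ≡ just w → π v d ≡ just w × ¬ (a ≡ v × c ≡ d) × ¬ (b ≡ v × rev c ≡ d)
      inv {v} {d} {w} e with same? a v c d | same? b v (rev c) d
      ... | yes (refl , refl) | _ = ⊥-elim (just≢nothing e new-a)
      ... | no _ | yes (refl , refl) = ⊥-elim (just≢nothing e new-b)
      ... | no h₁ | no h₂ = trans (sym (new-other h₁ h₂)) e , h₁ , h₂

      nothing-stays : ∀ {v d} → π v d ≡ nothing → new v d ≡ nothing
      nothing-stays {v} {d} e with new v d in r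
      ... | nothing = refl
      ... | just w  = ⊥-elim (just≢nothing (proj₁ (inv r)) e)

      valid : Valid new
      dom valid e = dom val (proj₁ (inv e))
      psym valid {v} {d} {w} e with inv e
      ... | o , h₁ , h₂ = trans (new-other
              (λ { (refl , refl) → h₂ (just-injective (trans (sym ab) (psym val o)) , rev-rev d) })
              (λ { (refl , r) → h₁ (just-injective (trans (sym (psym val ab)) (trans (cong (π b) r) (psym val o))) , rev-inj r) }))
            (psym val o)
      irr valid e = irr val (proj₁ (inv e))
      disj valid e e′ = disj val (proj₁ (inv e)) (proj₁ (inv e′))

    -- Rerouting may change partners, so `keeps` preserves only the fact that a half-edge is
    -- matched. This is enough for treating all half-edges one after another.
    record Extension (π : Partner) (a : V) (c : Fin m) : Set where
      field
        π′     : Partner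
        valid′ : Valid π′
        keeps  : ∀ {v d} → Matched π v d → Matched π′ v d
        gains  : uniq c ≡ true → uniq (rev c) ≡ true → mem (lab a) c ≡ true → Matched π′ a c
    open Extension

    -- If every vertex with `rev c` in its palette were matched, their partners would be distinct
    -- vertices with `c` in their palette, all different from `a`. The two degrees could then not be
    -- equal.
    unmatched : ∀ {π} → Valid π → ∀ a c → uniq c ≡ true → uniq (rev c) ≡ true → mem (lab a) c ≡ true →
      π a c ≡ nothing → ∃ λ b → mem (lab b) (rev c) ≡ true × π b (rev c) ≡ nothing
    unmatched {π} val a c u u′ ma ac
      with Finₚ.any? (λ b → (mem (lab b) (rev c) Boolₚ.≟ true) ×-dec (≡-dec _≟_ (π b (rev c)) nothing))
    ... | yes r = r
    ... | no ¬r = ⊥-elim (<-irrefl (sym (proj₂ (large c u (count-witness (λ v → mem (lab v) c) ma)) u′))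
                   (≤-trans (s≤s below) (≤-reflexive (sym (count-∖-true (λ v → mem (lab v) c) a ma)))))
      where
      partner : ∀ b → mem (lab b) (rev c) ≡ true → Matched π b (rev c)
      partner b mb with π b (rev c) in e
      ... | just w  = w , refl
      ... | nothing = ⊥-elim (¬r (b , mb , e))
      below : deg lab (rev c) ≤ countTrue ((λ v → mem (lab v) c) ∖ a)
      below = count-inj _ _ (λ b mb → proj₁ (partner b mb))
        (λ b mb → let w , e = partner b mb
                      e′ = psym⁻ val e
                  in ∖-intro (λ v → mem (lab v) c) {a}
                       (λ r → just≢nothing e′ (trans (cong (λ x → π x c) (sym r)) ac)) (proj₂ (proj₂ (dom val e′))))
        λ b b′ mb mb′ r →
          let w , e = partner b mb ; w′ , e′ = partner b′ mb′
          in just-injective (trans (sym (psym⁻ val e))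
               (trans (cong (λ x → π x c) r) (psym⁻ val e′)))

    -- Match a by c: either directly, or by rerouting the c-edge a′ — b′ to a — b′ and a′ — b.
    extend-matching : ∀ {π} → Valid π → ∀ a c → Extension π a c
    extend-matching {π} val a c with uniq c in u | uniq (rev c) in u′ | mem (lab a) c in ma | π a c in ac
    ... | false | _ | _ | _ = record { π′ = π ; valid′ = val ; keeps = λ x → x ; gains = λ x → ⊥-elim (true≢false x u) }
    ... | true | false | _ | _ = record { π′ = π ; valid′ = val ; keeps = λ x → x ; gains = λ _ x → ⊥-elim (true≢false x u′) }
    ... | true | true | false | _ = record { π′ = π ; valid′ = val ; keeps = λ x → x ; gains = λ _ _ x → ⊥-elim (true≢false x ma) }
    ... | true | true | true | just w =
          record { π′ = π ; valid′ = val ; keeps = λ x → x ; gains = λ _ _ _ → w , ac }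
    ... | true | true | true | nothing with unmatched val a c u u′ ma ac
    ...   | b , mb , bc = go (π b′ (rev c)) refl
      where
      bad′ : Fin m ⊎ Fin m → Maybe V
      bad′ (inj₁ d) = π a d
      bad′ (inj₂ d) = π b d >>= λ a′ → π a′ c
      -- The new partner `b′` must not be `a`, nor the `c`-partner of `b` (otherwise `a′` would be
      -- `b`), nor already joined to `a`. Nor may it be the `c`-partner of a vertex joined to `b`,
      -- since that vertex would be `a′`, which is to receive the free end `b`.
      bad : Fin (2 + (m + m)) → Maybe V
      bad zero          = just a
      bad (suc zero)    = π b c
      bad (suc (suc i)) = bad′ (splitAt m i)
      choice = count-avoid (λ v → mem (lab v) (rev c)) bad
        (≤-trans (s≤s (m≤m+n (2 + (m + m)) blocks)) (proj₁ (large c u (count-witness (λ v → mem (lab v) c) ma))))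
      b′ : V
      b′ = proj₁ choice
      mb′ : mem (lab b′) (rev c) ≡ true
      mb′ = proj₁ (proj₂ choice)
      a≢b′ : a ≢ b′
      a≢b′ r = proj₂ (proj₂ choice) zero (cong just r)
      free-ab′ : ∀ d → π a d ≢ just b′
      free-ab′ d e = proj₂ (proj₂ choice) (suc (suc (d ↑ˡ m))) (trans (cong bad′ (Finₚ.splitAt-↑ˡ m d m)) e)
      via-b : ∀ d {a′} → π b d ≡ just a′ → π a′ c ≢ just b′
      via-b d {a′} e e′ = proj₂ (proj₂ choice) (suc (suc (m ↑ʳ d)))
        (trans (cong bad′ (Finₚ.splitAt-↑ʳ m m d)) (trans (cong (_>>= λ x → π x c) e) e′))
      go : ∀ x → π b′ (rev c) ≡ x → Extension π a c
      go nothing b′c = record { π′ = A.new ; valid′ = A.valid ; keeps = A.keeps ; gains = λ _ _ _ → b′ , A.new-a }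
        where module A = Add val a c b′ a≢b′ ac b′c free-ab′ u u′ ma mb′
      go (just a′) b′c = record { π′ = B.new ; valid′ = B.valid ; keeps = keep ; gains = λ _ _ _ → b′ , B.old A.new-a }
        where
        a′c : π a′ c ≡ just b′
        a′c = psym⁻ val b′c
        a′≢a : a′ ≢ a
        a′≢a refl = just≢nothing a′c ac
        a′≢b : a′ ≢ b
        a′≢b refl = proj₂ (proj₂ choice) (suc zero) a′c
        a′≢b′ : a′ ≢ b′
        a′≢b′ = irr val a′c
        b≢b′ : b ≢ b′
        b≢b′ r = just≢nothing b′c (subst (λ x → π x (rev c) ≡ nothing) r bc)
        module D = Delete val a′ c b′ a′c
        module A = Add D.valid a c b′ a≢b′ (D.nothing-stays ac) D.new-b
          (λ d e → free-ab′ d (proj₁ (D.inv e))) u u′ ma mb′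
        free : ∀ d → A.New a′ d b → ⊥
        free d (A.isA p _ _) = a′≢a (sym p)
        free d (A.isB p _ _) = a′≢b′ (sym p)
        free d (A.isO o) = via-b (rev d) (psym val (proj₁ (D.inv o))) a′c
        module B = Add A.valid a′ c b a′≢b
          (trans (A.new-other (λ (p , _) → a′≢a (sym p)) (λ (p , _) → a′≢b′ (sym p))) D.new-a)
          -- Here `a` and `b` may be the same vertex. In that case it is `rev≢` that separates the
          -- half-edge just filled at `a` from the one still free at `b`.
          (trans (A.new-other (λ (_ , p) → rev≢ c (sym p)) (λ (p , _) → b≢b′ (sym p))) (D.nothing-stays bc))
          (λ d e → free d (A.inv e))
          u u′ (proj₂ (proj₂ (dom val a′c))) mb
        keep : ∀ {v d} → Matched π v d → Matched B.new v d
        keep {v} {d} (w , e) with same? a′ v c d | same? b′ v (rev c) d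
        ... | yes (refl , refl) | _ = b , B.new-a
        ... | no _ | yes (refl , refl) = a , B.old A.new-b
        ... | no h₁ | no h₂ = w , B.old (A.old (trans (D.new-other h₁ h₂) e))

    match-list : (l : List (V × Fin m)) → Σ Partner λ π → Valid π × (∀ {a c} → (a , c) ∈ l →
      uniq c ≡ true → uniq (rev c) ≡ true → mem (lab a) c ≡ true → Matched π a c)
    match-list [] = (λ _ _ → nothing) , record { dom = λ () ; psym = λ () ; irr = λ () ; disj = λ () } , λ ()
    match-list ((a , c) ∷ l) with match-list l
    ... | π , val , done with extend-matching val a c
    ...   | ext = π′ ext , valid′ ext , λ { (here refl) → gains ext ; (there i) u u′ ma → keeps ext (done i u u′ ma) }

    abstract
      matching : Σ Partner λ π → Valid π × (∀ a c →
        uniq c ≡ true → uniq (rev c) ≡ true → mem (lab a) c ≡ true → Matched π a c)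
      matching with match-list (cartesianProduct (allFin n) (allFin m))
      ... | π , val , done = π , val , λ a c → done (∈-cartesianProduct⁺ (∈-allFin a) (∈-allFin c))

    π : Partner
    π = proj₁ matching

    π-valid : Valid π
    π-valid = proj₁ (proj₂ matching)

    π-total : ∀ a c → uniq c ≡ true → uniq (rev c) ≡ true → mem (lab a) c ≡ true → Matched π a c
    π-total = proj₂ (proj₂ matching)

    -- Targets for the colours unique at one end only

    colour : Fin blocks → Fin m
    colour q = proj₁ (remQuot (3 * suc m) q)

    slot : Fin m → Fin 3 → Fin (suc m) → Fin blocks
    slot c i j = combine c (combine i j)

    colour-slot : ∀ c i j → colour (slot c i j) ≡ c
    colour-slot c i j = cong proj₁ (Finₚ.remQuot-combine c (combine i j))

    level : Fin blocks → Fin 3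
    level q = proj₁ (remQuot {3} (suc m) (proj₂ (remQuot {m} (3 * suc m) q)))

    level-slot : ∀ c i j → level (slot c i j) ≡ i
    level-slot c i j = trans (cong (λ z → proj₁ (remQuot {3} (suc m) (proj₂ z))) (Finₚ.remQuot-combine c (combine i j)))
                             (cong proj₁ (Finₚ.remQuot-combine i j))

    -- Abundance of other ends is guaranteed only for colours that occur in some palette, so targets
    -- are reserved for these alone.
    live : Fin m → Bool
    live c = uniq c ∧ not (uniq (rev c)) ∧ does (0 <? deg lab c)

    -- Pairwise disjoint blocks of m + 1 targets, three blocks for each colour that is unique at one end only.
    abstract
      targets : Σ (Fin blocks → Maybe V) λ t →
        (∀ q → live (colour q) ≡ true → ∃ λ v → t q ≡ just v) ×
        (∀ q v → t q ≡ just v → mem (lab v) (rev (colour q)) ≡ true) ×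
        (∀ q q′ v → t q ≡ just v → t q′ ≡ just v → q ≡ q′)
      targets = distinct-reps {n} {blocks} (λ q → live (colour q)) (λ q v → mem (lab v) (rev (colour q)))
        λ q l → let u , l′ = ∧-true l
                    _ , l″ = ∧-true {not (uniq (rev (colour q)))} l′
                in ≤-trans (≤-trans (m≤n+m blocks (2 + (m + m))) (n≤1+n _))
                           (proj₁ (large (colour q) u (does-true (0 <? deg lab (colour q)) l″)))

    target : Fin blocks → Maybe V
    target = proj₁ targets

    target-live : ∀ q → live (colour q) ≡ true → ∃ λ v → target q ≡ just v
    target-live = proj₁ (proj₂ targets)

    target-mem : ∀ q v → target q ≡ just v → mem (lab v) (rev (colour q)) ≡ true
    target-mem = proj₁ (proj₂ (proj₂ targets))

    target-inj : ∀ q q′ v → target q ≡ just v → target q′ ≡ just v → q ≡ q′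
    target-inj = proj₂ (proj₂ (proj₂ targets))

    next : Fin 3 → Fin 3
    next zero          = suc zero
    next (suc zero)    = suc (suc zero)
    next (suc (suc _)) = zero

    next≢ : ∀ i → next i ≢ i
    next≢ zero ()
    next≢ (suc zero) ()
    next≢ (suc (suc zero)) ()

    next-next≢ : ∀ i → next (next i) ≢ i
    next-next≢ zero ()
    next-next≢ (suc zero) ()
    next-next≢ (suc (suc zero)) ()

    -- A vertex picks its targets at its source level, and a target of level i has source level i + 1
    -- (mod 3), so no two vertices ever pick each other.
    source : V → Fin 3
    source v with Finₚ.any? (λ q → ≡-dec _≟_ (target q) (just v))
    ... | yes (q , _) = next (level q)
    ... | no _        = zero

    source-target : ∀ q v → target q ≡ just v → source v ≡ next (level q)
    source-target q v e with Finₚ.any? (λ q → ≡-dec _≟_ (target q) (just v))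
    ... | yes (q′ , e′) = cong (next ∘ level) (target-inj q′ q v e′ e)
    ... | no ¬q         = ⊥-elim (¬q (q , e))

    record Pick (v : V) (c : Fin m) (w : V) : Set where
      field
        uniq-c : uniq c ≡ true
        many-c : uniq (rev c) ≡ false
        mem-v  : mem (lab v) c ≡ true
        mem-w  : mem (lab w) (rev c) ≡ true
        fresh  : ∀ d → π v d ≢ just w
        index  : Fin (suc m)
        at     : target (slot c (source v) index) ≡ just w
    open Pick

    abstract
      pick-exists : ∀ v c → uniq c ≡ true → uniq (rev c) ≡ false → mem (lab v) c ≡ true → ∃ (Pick v c)
      pick-exists v c u u′ mv =
        let w , fw , fr = count-avoid f (π v) big
            j , e = does-true (there? w) fw
        in w , record { uniq-c = u ; many-c = u′ ; mem-v = mv ; fresh = fr ; index = j ; at = e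
                      ; mem-w = subst (λ d → mem (lab w) (rev d) ≡ true) (colour-slot c (source v) j)
                                  (target-mem (slot c (source v) j) w e) }
        where
        at? : Fin (suc m) → Maybe V
        at? j = target (slot c (source v) j)
        is-live : ∀ j → live (colour (slot c (source v) j)) ≡ true
        is-live j rewrite colour-slot c (source v) j =
          ∧-intro u (∧-intro (not-false u′) (dec-true (0 <? deg lab c) (count-witness (λ v → mem (lab v) c) mv)))
        there? : ∀ w → Dec (∃ λ j → at? j ≡ just w)
        there? w = Finₚ.any? (λ j → ≡-dec _≟_ (at? j) (just w))
        f : V → Bool
        f w = does (there? w)
        elem : ∀ j → ∃ λ w → at? j ≡ just w
        elem j = target-live (slot c (source v) j) (is-live j)
        big : m < countTrue f
        big = subst (_≤ countTrue f) (count-true (suc m))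
          (count-inj {suc m} (λ _ → true) f (λ j _ → proj₁ (elem j))
            (λ j _ → dec-true (there? _) (j , proj₂ (elem j)))
            λ j j′ _ _ r → Finₚ.combine-injectiveʳ (source v) j (source v) j′
               (Finₚ.combine-injectiveʳ c (combine (source v) j) c (combine (source v) j′)
                 (target-inj _ _ _ (proj₂ (elem j)) (trans (proj₂ (elem j′)) (cong just (sym r))))))

      picks : ∀ v c → Σ (Maybe V) λ x → (∀ w → x ≡ just w → Pick v c w) ×
        (uniq c ≡ true → uniq (rev c) ≡ false → mem (lab v) c ≡ true → ∃ λ w → x ≡ just w)
      picks v c with bool? (uniq c) | bool? (uniq (rev c)) | bool? (mem (lab v) c)
      ... | inj₂ u | _ | _ = nothing , (λ _ ()) , λ u′ _ _ → ⊥-elim (true≢false u′ u)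
      ... | _ | inj₁ u | _ = nothing , (λ _ ()) , λ _ u′ _ → ⊥-elim (true≢false u u′)
      ... | _ | _ | inj₂ u = nothing , (λ _ ()) , λ _ _ u′ → ⊥-elim (true≢false u′ u)
      ... | inj₁ u | inj₂ u′ | inj₁ mv =
        let w , pk = pick-exists v c u u′ mv
        in just w , (λ _ r → subst (Pick v c) (just-injective r) pk) , λ _ _ _ → w , refl

    τ : V → Fin m → Maybe V
    τ v c = proj₁ (picks v c)

    τ-pick : ∀ {v c w} → τ v c ≡ just w → Pick v c w
    τ-pick {v} {c} {w} = proj₁ (proj₂ (picks v c)) w

    τ-total : ∀ v c → uniq c ≡ true → uniq (rev c) ≡ false → mem (lab v) c ≡ true → ∃ λ w → τ v c ≡ just w
    τ-total v c = proj₂ (proj₂ (picks v c))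

    source-pick : ∀ {v c w} → Pick v c w → source w ≡ next (source v)
    source-pick {v} {c} {w} pk = trans (source-target _ w (at pk)) (cong next (level-slot c (source v) (index pk)))

    -- Assembling the colouring

    data Edge (v : V) (c : Fin m) (w : V) : Set where
      match : π v c ≡ just w → Edge v c w
      out   : τ v c ≡ just w → Edge v c w
      into  : τ w (rev c) ≡ just v → Edge v c w

    edge? : ∀ v c w → Dec (Edge v c w)
    edge? v c w with ≡-dec _≟_ (π v c) (just w) | ≡-dec _≟_ (τ v c) (just w) | ≡-dec _≟_ (τ w (rev c)) (just v)
    ... | yes p | _     | _     = yes (match p)
    ... | no _  | yes p | _     = yes (out p)
    ... | no _  | no _  | yes p = yes (into p)
    ... | no x  | no y  | no z  = no λ { (match p) → x p ; (out p) → y p ; (into p) → z p }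

    edge-sym : ∀ {v c w} → Edge v c w → Edge w (rev c) v
    edge-sym (match p) = match (psym π-valid p)
    edge-sym {v} {c} {w} (out p) = into (subst (λ d → τ v d ≡ just w) (sym (rev-rev c)) p)
    edge-sym (into p)  = out p

    τ-colour : ∀ {v c d w} → τ v c ≡ just w → τ v d ≡ just w → c ≡ d
    τ-colour {v} {c} {d} {w} p q =
      Finₚ.combine-injectiveˡ c (combine (source v) (index (τ-pick p))) d (combine (source v) (index (τ-pick q)))
        (target-inj _ _ w (at (τ-pick p)) (at (τ-pick q)))

    no-mutual : ∀ {v c d w} → τ v c ≡ just w → τ w d ≡ just v → ⊥
    no-mutual {v} p q = next-next≢ (source v)
      (trans (cong next (sym (source-pick (τ-pick p)))) (sym (source-pick (τ-pick q))))

    -- No pair is claimed twice: picks avoid the matching partners, a target lies in the block of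
    -- one colour only, and the cyclic levels exclude mutual picks.
    edge-colour : ∀ {v c d w} → Edge v c w → Edge v d w → c ≡ d
    edge-colour (match p) (match q) = disj π-valid p q
    edge-colour (match p) (out q)   = ⊥-elim (fresh (τ-pick q) _ p)
    edge-colour (match p) (into q)  = ⊥-elim (fresh (τ-pick q) _ (psym π-valid p))
    edge-colour (out p)   (match q) = ⊥-elim (fresh (τ-pick p) _ q)
    edge-colour (out p)   (out q)   = τ-colour p q
    edge-colour (out p)   (into q)  = ⊥-elim (no-mutual p q)
    edge-colour (into p)  (match q) = ⊥-elim (fresh (τ-pick p) _ (psym π-valid q))
    edge-colour (into p)  (out q)   = ⊥-elim (no-mutual p q)
    edge-colour (into p)  (into q)  = rev-inj (τ-colour p q)

    edge-mem : ∀ {v c w} → Edge v c w → mem (lab v) c ≡ true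
    edge-mem (match p) = proj₂ (proj₂ (dom π-valid p))
    edge-mem (out p)   = mem-v (τ-pick p)
    edge-mem {v} {c} (into p) = subst (λ d → mem (lab v) d ≡ true) (rev-rev c) (mem-w (τ-pick p))

    edge-irr : ∀ {v c w} → Edge v c w → v ≢ w
    edge-irr (match p)    = irr π-valid p
    edge-irr (out p) refl = next≢ _ (sym (source-pick (τ-pick p)))
    edge-irr (into p) refl = next≢ _ (sym (source-pick (τ-pick p)))

    -- An edge that comes in as a pick of the other end is non-unique at the receiving end. A vertex
    -- may therefore be picked any number of times without harm.
    edge-target : ∀ {v c w w′} → uniq c ≡ true → Edge v c w → Edge v c w′ → w ≡ w′
    edge-target u (match p) (match q) = just-injective (trans (sym p) q)
    edge-target u (match p) (out q)   = ⊥-elim (true≢false (proj₁ (proj₂ (dom π-valid p))) (many-c (τ-pick q)))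
    edge-target u (out p)   (match q) = ⊥-elim (true≢false (proj₁ (proj₂ (dom π-valid q))) (many-c (τ-pick p)))
    edge-target u (out p)   (out q)   = just-injective (trans (sym p) q)
    edge-target {c = c} u (into p) _  = ⊥-elim (true≢false (trans (cong uniq (rev-rev c)) u) (many-c (τ-pick p)))
    edge-target {c = c} u _ (into p)  = ⊥-elim (true≢false (trans (cong uniq (rev-rev c)) u) (many-c (τ-pick p)))

    edge-total : ∀ v c → uniq c ≡ true → mem (lab v) c ≡ true → ∃ λ w → Edge v c w
    edge-total v c u mv with bool? (uniq (rev c))
    ... | inj₁ u′ = let w , e = π-total v c u u′ mv in w , match e
    ... | inj₂ u′ = let w , e = τ-total v c u u′ mv in w , out e

    edgeColour? : ∀ v w → Dec (∃ λ c → Edge v c w)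
    edgeColour? v w = Finₚ.any? (λ c → edge? v c w)

    record Default (v w : V) (c : Fin m) : Set where
      field
        many  : uniq c ≡ false
        mem-c : mem (lab v) c ≡ true
    open Default

    -- `compat` may choose unrelated colours for the two orders of a pair, so it is consulted in one
    -- order and reversed for the other.
    defaults : V → V → Fin m
    defaults v w with Finₚ.<-cmp v w
    ... | tri< _ v≢w _ = proj₁ (compat v w v≢w)
    ... | tri≈ _ _ _   = c₀
    ... | tri> _ v≢w _ = rev (proj₁ (compat w v (v≢w ∘ sym)))

    defaults-sym : ∀ v w → v ≢ w → defaults w v ≡ rev (defaults v w)
    defaults-sym v w v≢w with Finₚ.<-cmp v w | Finₚ.<-cmp w v
    ... | tri< _ _ _   | tri> _ _ _   = refl
    ... | tri> _ _ _   | tri< _ _ _   = sym (rev-rev _)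
    ... | tri≈ _ r _   | _            = ⊥-elim (v≢w r)
    ... | _            | tri≈ _ r _   = ⊥-elim (v≢w (sym r))
    ... | tri< _ _ ¬p  | tri< p _ _   = ⊥-elim (¬p p)
    ... | tri> ¬p _ _  | tri> _ _ p   = ⊥-elim (¬p p)

    defaults-ok : ∀ v w → v ≢ w → Default v w (defaults v w)
    defaults-ok v w v≢w with Finₚ.<-cmp v w
    ... | tri< _ v≢w _ = let c , u , _ , mv , _ = compat v w v≢w in record { many = u ; mem-c = mv }
    ... | tri≈ _ r _   = ⊥-elim (v≢w r)
    ... | tri> _ v≢w _ = let c , _ , u , _ , mv = compat w v (v≢w ∘ sym) in record { many = u ; mem-c = mv }

    χ₀ : V → V → Fin m
    χ₀ v w with edgeColour? v w
    ... | yes (c , _) = c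
    ... | no _        = defaults v w

    χ₀-edge : ∀ {v c w} → Edge v c w → χ₀ v w ≡ c
    χ₀-edge {v} {c} {w} e with edgeColour? v w
    ... | yes (d , e′) = edge-colour e′ e
    ... | no h         = ⊥-elim (h (c , e))

    χ₀-cases : ∀ v w → v ≢ w → Edge v (χ₀ v w) w ⊎ (¬ (∃ λ c → Edge v c w)) × χ₀ v w ≡ defaults v w
    χ₀-cases v w v≢w with edgeColour? v w
    ... | yes (c , e) = inj₁ e
    ... | no h        = inj₂ (h , refl)

    χ₀-uniq : ∀ v w → v ≢ w → uniq (χ₀ v w) ≡ true → Edge v (χ₀ v w) w
    χ₀-uniq v w v≢w u with χ₀-cases v w v≢w
    ... | inj₁ e       = e
    ... | inj₂ (_ , r) = ⊥-elim (true≢false u (trans (cong uniq r) (many (defaults-ok v w v≢w))))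

    realise : Colouring lab
    realise = record
      { χ        = χ₀
      ; χ-sym    = λ {v} {w} → χ₀-sym v w
      ; χ-mem    = λ {v} {w} → χ₀-mem v w
      ; χ-exists = λ {v} {c} u mv → let w , e = edge-total v c u mv in w , edge-irr e , χ₀-edge e
      ; χ-unique = λ {v} {w} {w′} v≢w v≢w′ u r → edge-target u (χ₀-uniq v w v≢w u)
          (subst (λ c → Edge v c w′) (sym r) (χ₀-uniq v w′ v≢w′ (trans (cong uniq (sym r)) u)))
      }
      where
      χ₀-sym : ∀ v w → v ≢ w → χ₀ w v ≡ rev (χ₀ v w)
      χ₀-sym v w v≢w with χ₀-cases v w v≢w | χ₀-cases w v (v≢w ∘ sym)
      ... | inj₁ e       | _ = χ₀-edge (edge-sym e)
      ... | inj₂ (h , r) | inj₁ e = ⊥-elim (h (_ , edge-sym e))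
      ... | inj₂ (h , r) | inj₂ (_ , r′) = trans r′ (trans (defaults-sym v w v≢w) (cong rev (sym r)))
      χ₀-mem : ∀ v w → v ≢ w → mem (lab v) (χ₀ v w) ≡ true
      χ₀-mem v w v≢w with χ₀-cases v w v≢w
      ... | inj₁ e       = edge-mem e
      ... | inj₂ (_ , r) = trans (cong (mem (lab v)) r) (mem-c (defaults-ok v w v≢w))

-- Removal of vertices

module Kings
  (m : ℕ) (c₀ : Fin m) (rev : Fin m → Fin m)
  (rev-rev : ∀ c → rev (rev c) ≡ c) (rev≢ : ∀ c → rev c ≢ c)
  (uniq : Fin m → Bool)
  (P : ℕ) (mem : Fin P → Fin m → Bool)
  (upd : Fin P → Fin m → Fin P)
  (mem-upd : ∀ p c d → mem (upd p c) d ≡ mem p d ∧ not (uniq d ∧ (c == d)))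
  (G : ℕ) (grp : Fin P → Fin G)
  (grp-upd : ∀ p c → grp (upd p c) ≡ grp p)
  (grp-mem : ∀ p q d → grp p ≡ grp q → uniq d ≡ false → mem p d ≡ mem q d)
  where

  open Palettes m c₀ rev rev-rev rev≢ uniq P mem
  open Colouring

  compat? : ∀ p q → Dec (Compat p q)
  compat? p q = Finₚ.any? λ c → (uniq c Boolₚ.≟ false) ×-dec (uniq (rev c) Boolₚ.≟ false)
                  ×-dec (mem p c Boolₚ.≟ true) ×-dec (mem q (rev c) Boolₚ.≟ true)

  total : (Fin P → ℕ) → Fin m → ℕ
  total x c = sumWhere (λ p → mem p c) x

  -- The hypotheses of `Realise` in terms of counts. The alternative `p ≡ q` with `x p ≤ 1` is there
  -- because a palette held by a single vertex need not be compatible with itself.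
  Nice : (Fin P → ℕ) → Set
  Nice x =
    (∀ p q → Compat p q ⊎ x p ≡ 0 ⊎ x q ≡ 0 ⊎ (p ≡ q × x p ≤ 1)) ×
    (∀ c → uniq c ≡ false ⊎ total x c ≡ 0 ⊎
      (suc threshold ≤ total x (rev c) × (uniq (rev c) ≡ false ⊎ total x c ≡ total x (rev c))))

  Nice-cong : ∀ {x x′} → (∀ p → x p ≡ x′ p) → Nice x → Nice x′
  Nice-cong {x} {x′} r (h₁ , h₂) = (λ p q → go₁ p q (h₁ p q)) , λ c → go₂ c (h₂ c)
    where
    rt : ∀ c → total x c ≡ total x′ c
    rt c = sumWhere-cong (λ p → mem p c) r
    go₁ : ∀ p q → _ → Compat p q ⊎ x′ p ≡ 0 ⊎ x′ q ≡ 0 ⊎ (p ≡ q × x′ p ≤ 1)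
    go₁ p q (inj₁ h) = inj₁ h
    go₁ p q (inj₂ (inj₁ h)) = inj₂ (inj₁ (trans (sym (r p)) h))
    go₁ p q (inj₂ (inj₂ (inj₁ h))) = inj₂ (inj₂ (inj₁ (trans (sym (r q)) h)))
    go₁ p q (inj₂ (inj₂ (inj₂ (e , h)))) = inj₂ (inj₂ (inj₂ (e , subst (_≤ 1) (r p) h)))
    go₂ : ∀ c → _ → uniq c ≡ false ⊎ total x′ c ≡ 0 ⊎
      (suc threshold ≤ total x′ (rev c) × (uniq (rev c) ≡ false ⊎ total x′ c ≡ total x′ (rev c)))
    go₂ c (inj₁ h) = inj₁ h
    go₂ c (inj₂ (inj₁ h)) = inj₂ (inj₁ (trans (sym (rt c)) h))
    go₂ c (inj₂ (inj₂ (h , inj₁ u))) = inj₂ (inj₂ (subst (suc threshold ≤_) (rt (rev c)) h , inj₁ u))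
    go₂ c (inj₂ (inj₂ (h , inj₂ u))) = inj₂ (inj₂ (subst (suc threshold ≤_) (rt (rev c)) h ,
                                          inj₂ (trans (sym (rt c)) (trans u (rt (rev c))))))

  pal : Fin (P * m) → Fin P
  pal z = proj₁ (remQuot {P} m z)

  col : Fin (P * m) → Fin m
  col z = proj₂ (remQuot {P} m z)

  pal-combine : ∀ p c → pal (combine p c) ≡ p
  pal-combine p c = cong proj₁ (Finₚ.remQuot-combine p c)

  col-combine : ∀ p c → col (combine {P} p c) ≡ c
  col-combine p c = cong proj₂ (Finₚ.remQuot-combine {P} p c)

  res : Fin (P * m) → Fin P
  res z = upd (pal z) (col z)

  -- y z counts the vertices of palette pal z joined by colour col z to a removed vertex of palette p₀.
  King : (x x′ : Fin P → ℕ) (y : Fin (P * m) → ℕ) → Fin P → Set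
  King x x′ y p₀ =
    (∀ p → x p ≡ b2n (p₀ == p) + sumWhere (λ z → pal z == p) y) ×
    (∀ z → y z ≡ 0 ⊎ (mem (pal z) (col z) ≡ true × mem p₀ (rev (col z)) ≡ true)) ×
    (∀ c → uniq c ≡ false ⊎ mem p₀ c ≡ false ⊎ sumWhere (λ z → col z == rev c) y ≡ 1) ×
    (∀ q → x′ q ≡ sumWhere (λ z → res z == q) y)

  Step : (x x′ : Fin P → ℕ) (y : Fin (P * m) → ℕ) → Set
  Step x x′ y = (∀ p → x p ≡ x′ p) ⊎ ∃ (King x x′ y)

  -- The recursion is on a number known when the formula is built, so it unfolds to a finite
  -- formula. A `Step` may be idle; hence `B` only bounds the number of removals.
  Reducible : ℕ → (Fin P → ℕ) → Set
  Reducible zero    x = Nice x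
  Reducible (suc B) x = Σ (Vec ℕ P) λ x′ → Σ (Vec ℕ (P * m)) λ y →
    Step x (lookup x′) (lookup y) × Reducible B (lookup x′)

  module _ {M : ℕ} {E : Set} {e : E → Vec ℕ M} where

    NiceD : ∀ {x : Fin P → E → ℕ} → (∀ p → TermFor e (x p)) → DecDefn e (λ ε → Nice (λ p → x p ε))
    NiceD t =
      (∀D λ p → ∀D λ q → static (compat? p q) ⊎D (t p ≡D constT 0) ⊎D (t q ≡D constT 0)
        ⊎D (static (p ≟ q) ×D t p ≤D constT 1))
      ×D
      (∀D λ c → static (uniq c Boolₚ.≟ false) ⊎D (tot c ≡D constT 0)
        ⊎D ((constT (suc threshold) ≤D tot (rev c)) ×D (static (uniq (rev c) Boolₚ.≟ false) ⊎D (tot c ≡D tot (rev c)))))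
      where
      tot = λ c → sumWhereT (λ p → mem p c) t

    StepD : ∀ {x x′ : Fin P → E → ℕ} {y : Fin (P * m) → E → ℕ} →
      (∀ p → TermFor e (x p)) → (∀ p → TermFor e (x′ p)) → (∀ z → TermFor e (y z)) →
      DecDefn e (λ ε → Step (λ p → x p ε) (λ p → x′ p ε) (λ z → y z ε))
    StepD t t′ s = (∀D λ p → t p ≡D t′ p) ⊎D (∃D λ p₀ →
      (∀D λ p → t p ≡D (constT (b2n (p₀ == p)) +T sumWhereT (λ z → pal z == p) s))
      ×D (∀D λ z → (s z ≡D constT 0) ⊎D
            static ((mem (pal z) (col z) Boolₚ.≟ true) ×-dec (mem p₀ (rev (col z)) Boolₚ.≟ true)))
      ×D (∀D λ c → static (uniq c Boolₚ.≟ false) ⊎D static (mem p₀ c Boolₚ.≟ false)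
            ⊎D (sumWhereT (λ z → col z == rev c) s ≡D constT 1))
      ×D (∀D λ q → t′ q ≡D sumWhereT (λ z → res z == q) s))

  ReducibleD : ∀ B {M : ℕ} {E : Set} {e : E → Vec ℕ M} {x : Fin P → E → ℕ} →
    (∀ p → TermFor e (x p)) → Defn e (λ ε → Reducible B (λ p → x p ε))
  ReducibleD zero    t = DecDefn.defn (NiceD t)
  ReducibleD (suc B) t = ΣD (ΣD
    (DecDefn.defn (StepD (λ p → weakenT (weakenT (t p))) (λ p → weakenT (newVarT p)) newVarT)
      ∩ ReducibleD B (λ p → weakenT (newVarT p))))

  -- From reductions to colourings

  Realisable : (Fin P → ℕ) → Set
  Realisable x = ∃ λ n → Σ (Fin n → Fin P) λ lab → (∀ p → cnt-label lab p ≡ x p) × Colouring lab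

  nice⇒realisable : ∀ x → Nice x → Realisable x
  nice⇒realisable x (h₁ , h₂) = ∑ x , lab , num , Realise.realise lab compat large
    where
    lab = proj₁ (labels-with-counts x)
    num = proj₂ (labels-with-counts x)
    deg-total : ∀ c → deg lab c ≡ total x c
    deg-total c = trans (count-label (λ p → mem p c) lab) (sumWhere-cong (λ p → mem p c) num)
    nonzero : ∀ v → x (lab v) ≢ 0
    nonzero v r = <-irrefl (sym (trans (num (lab v)) r)) (count-witness (λ w → lab w == lab v) (==-refl (lab v)))
    compat : ∀ v w → v ≢ w → Compat (lab v) (lab w)
    compat v w v≢w with h₁ (lab v) (lab w)
    ... | inj₁ c = c
    ... | inj₂ (inj₁ r) = ⊥-elim (nonzero v r)
    ... | inj₂ (inj₂ (inj₁ r)) = ⊥-elim (nonzero w r)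
    ... | inj₂ (inj₂ (inj₂ (r , le))) = ⊥-elim (<-irrefl refl (≤-trans
            (count-two (λ u → lab u == lab v) v≢w (==-refl (lab v)) (trans (cong (_== lab v) (sym r)) (==-refl (lab v))))
            (≤-trans (≤-reflexive (num (lab v))) le)))
    large : ∀ c → uniq c ≡ true → 0 < deg lab c →
      threshold < deg lab (rev c) × (uniq (rev c) ≡ true → deg lab c ≡ deg lab (rev c))
    large c u pos with h₂ c
    ... | inj₁ f = ⊥-elim (true≢false u f)
    ... | inj₂ (inj₁ z) = ⊥-elim (<-irrefl (sym (trans (deg-total c) z)) pos)
    ... | inj₂ (inj₂ (big , bal)) = subst (threshold <_) (sym (deg-total (rev c))) big , go bal
      where
      go : uniq (rev c) ≡ false ⊎ total x c ≡ total x (rev c) → uniq (rev c) ≡ true → deg lab c ≡ deg lab (rev c)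
      go (inj₁ f) u′ = ⊥-elim (true≢false u′ f)
      go (inj₂ r) _  = trans (deg-total c) (trans r (sym (deg-total (rev c))))

  -- The residual counts `x′` are sums of `y`, so the residual labelling lifts to one by pairs of an
  -- original palette and a colour. These pairs say how to join each vertex to the restored one.
  king⇒realisable : ∀ x x′ y p₀ → King x x′ y p₀ → Realisable x′ → Realisable x
  king⇒realisable x x′ y p₀ (hx , legal , once , hx′) (n , lab′ , cnt′ , C) =
    suc n , lab , num , record
      { χ        = χ⁺
      ; χ-sym    = λ {a} {b} → sym⁺ a b
      ; χ-mem    = λ {a} {b} → mem⁺ a b
      ; χ-exists = λ {a} {c} → ex⁺ a c
      ; χ-unique = λ {a} {b} {b′} → uq⁺ a b b′ }
    where
    lifted = lift-labels res lab′ y (λ q → trans (cnt′ q) (hx′ q))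
    ℓ = proj₁ lifted
    ℓ-res : ∀ v → res (ℓ v) ≡ lab′ v
    ℓ-res = proj₁ (proj₂ lifted)
    ℓ-cnt : ∀ z → cnt-label ℓ z ≡ y z
    ℓ-cnt = proj₂ (proj₂ lifted)
    k : Fin n → Fin m
    k v = col (ℓ v)
    lab : Fin (suc n) → Fin P
    lab zero    = p₀
    lab (suc v) = pal (ℓ v)
    num : ∀ p → cnt-label lab p ≡ x p
    num p = trans (cong (b2n (p₀ == p) +_) (trans (count-label (λ z → pal z == p) ℓ)
                                                  (sumWhere-cong (λ z → pal z == p) ℓ-cnt))) (sym (hx p))
    legal′ : ∀ v → mem (pal (ℓ v)) (k v) ≡ true × mem p₀ (rev (k v)) ≡ true
    legal′ v with legal (ℓ v)
    ... | inj₂ h = h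
    ... | inj₁ r = ⊥-elim (<-irrefl (sym (trans (ℓ-cnt (ℓ v)) r)) (count-witness (λ w → ℓ w == ℓ v) (==-refl (ℓ v))))
    only : ∀ c → uniq c ≡ true → mem p₀ c ≡ true → ∃ λ v → (k v == rev c) ≡ true × (∀ w → (k w == rev c) ≡ true → v ≡ w)
    only c u mc with once c
    ... | inj₁ f = ⊥-elim (true≢false u f)
    ... | inj₂ (inj₁ f) = ⊥-elim (true≢false mc f)
    ... | inj₂ (inj₂ r) = count≡1 (λ v → k v == rev c)
            (trans (count-label (λ z → col z == rev c) ℓ) (trans (sumWhere-cong (λ z → col z == rev c) ℓ-cnt) r))
    mem-lab′ : ∀ v d → mem (lab′ v) d ≡ mem (pal (ℓ v)) d ∧ not (uniq d ∧ (k v == d))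
    mem-lab′ v d = trans (cong (λ q → mem q d) (sym (ℓ-res v))) (mem-upd (pal (ℓ v)) (k v) d)
    -- A unique colour spent on the edge to the restored vertex is absent from the residual palette,
    -- so no older edge can repeat it.
    used : ∀ v → uniq (k v) ≡ true → mem (lab′ v) (k v) ≡ true → ⊥
    used v u h = true≢false (∧-intro u (==-refl (k v)))
      (not-true (proj₂ (∧-true {mem (pal (ℓ v)) (k v)} (trans (sym (mem-lab′ v (k v))) h))))
    χ⁺ : Fin (suc n) → Fin (suc n) → Fin m
    χ⁺ zero    zero    = c₀
    χ⁺ zero    (suc v) = rev (k v)
    χ⁺ (suc v) zero    = k v
    χ⁺ (suc v) (suc w) = χ C v w
    sym⁺ : ∀ a b → a ≢ b → χ⁺ b a ≡ rev (χ⁺ a b)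
    sym⁺ zero    zero    h = ⊥-elim (h refl)
    sym⁺ zero    (suc v) h = sym (rev-rev (k v))
    sym⁺ (suc v) zero    h = refl
    sym⁺ (suc v) (suc w) h = χ-sym C (h ∘ cong suc)
    mem⁺ : ∀ a b → a ≢ b → mem (lab a) (χ⁺ a b) ≡ true
    mem⁺ zero    zero    h = ⊥-elim (h refl)
    mem⁺ zero    (suc v) h = proj₂ (legal′ v)
    mem⁺ (suc v) zero    h = proj₁ (legal′ v)
    mem⁺ (suc v) (suc w) h = proj₁ (∧-true (trans (sym (mem-lab′ v (χ C v w))) (χ-mem C (h ∘ cong suc))))
    ex⁺ : ∀ a c → uniq c ≡ true → mem (lab a) c ≡ true → ∃ λ b → a ≢ b × χ⁺ a b ≡ c
    ex⁺ zero c u mc with only c u mc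
    ... | v , kv , _ = suc v , (λ ()) , trans (cong rev (==⇒≡ (k v) (rev c) kv)) (rev-rev c)
    ex⁺ (suc v) c u mc with k v ≟ c
    ... | yes r = zero , (λ ()) , r
    ... | no ¬r with χ-exists C {v} {c} u (trans (mem-lab′ v c)
                       (∧-intro mc (not-false (trans (cong (uniq c ∧_) (≢⇒== ¬r)) (Boolₚ.∧-zeroʳ (uniq c))))))
    ...   | w , v≢w , e = suc w , (λ r → v≢w (Finₚ.suc-injective r)) , e
    uq⁺ : ∀ a b b′ → a ≢ b → a ≢ b′ → uniq (χ⁺ a b) ≡ true → χ⁺ a b ≡ χ⁺ a b′ → b ≡ b′
    uq⁺ zero zero    b′ h h′ u r = ⊥-elim (h refl)
    uq⁺ zero (suc v) zero h h′ u r = ⊥-elim (h′ refl)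
    uq⁺ zero (suc v) (suc w) h h′ u r with only (rev (k v)) u (proj₂ (legal′ v))
    ... | o , _ , one′ = cong suc (trans (sym (one′ v (is v (sym (rev-rev (k v)))))) (one′ w (is w (sym (trans (cong rev r) (rev-rev (k w)))))))
      where
      is : ∀ w {d} → k w ≡ d → (k w == d) ≡ true
      is w refl = ==-refl (k w)
    uq⁺ (suc v) zero zero h h′ u r = refl
    uq⁺ (suc v) zero (suc w) h h′ u r =
      ⊥-elim (used v u (subst (λ d → mem (lab′ v) d ≡ true) (sym r) (χ-mem C (h′ ∘ cong suc))))
    uq⁺ (suc v) (suc w) zero h h′ u r =
      ⊥-elim (used v (trans (cong uniq (sym r)) u) (subst (λ d → mem (lab′ v) d ≡ true) r (χ-mem C (h ∘ cong suc))))
    uq⁺ (suc v) (suc w) (suc w′) h h′ u r = cong suc (χ-unique C (h ∘ cong suc) (h′ ∘ cong suc) u r)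

  reducible⇒realisable : ∀ B x → Reducible B x → Realisable x
  reducible⇒realisable zero    x h = nice⇒realisable x h
  reducible⇒realisable (suc B) x (x′ , y , inj₁ r , h) with reducible⇒realisable B (lookup x′) h
  ... | n , lab , num , C = n , lab , (λ p → trans (num p) (sym (r p))) , C
  reducible⇒realisable (suc B) x (x′ , y , inj₂ (p₀ , K) , h) =
    king⇒realisable x (lookup x′) (lookup y) p₀ K (reducible⇒realisable B (lookup x′) h)

  nice⇒reducible : ∀ B x → Nice x → Reducible B x
  nice⇒reducible zero    x h = h
  nice⇒reducible (suc B) x h = tabulate x , replicate (P * m) 0 ,
    inj₁ (λ p → sym (lookup∘tabulate x p)) ,
    nice⇒reducible B _ (Nice-cong (λ p → sym (lookup∘tabulate x p)) h)

  -- A group consists of palettes with the same non-unique colours. Compatibility depends on groups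
  -- only, and removing a vertex leaves the groups of the others unchanged.
  size : ∀ {n} → (Fin n → Fin P) → Fin G → ℕ
  size lab g = countTrue (λ v → grp (lab v) == g)

  -- A pair is coded by one of its ends and a colour unique there, so there are only linearly many pairs.
  module FewPairs {n : ℕ} {lab : Fin n → Fin P} (C : Colouring lab) (s : ℕ) (xs ys : Fin s → Fin n)
    (xs-inj : ∀ i j → xs i ≡ xs j → i ≡ j) (ys-inj : ∀ i j → ys i ≡ ys j → i ≡ j)
    (pair : ∀ i j → xs i ≢ ys j → uniq (χ C (xs i) (ys j)) ≡ true ⊎ uniq (χ C (ys j) (xs i)) ≡ true)
    where

    -- The two families may overlap; the code `zero` serves the pairs whose ends coincide, of which
    -- there is at most one for each `i`.
    data Code (i j : Fin s) : Fin s → Fin (suc (m + m)) → Set where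
      same : xs i ≡ ys j → Code i j i zero
      outx : xs i ≢ ys j → uniq (χ C (xs i) (ys j)) ≡ true → Code i j i (suc (χ C (xs i) (ys j) ↑ˡ m))
      outy : xs i ≢ ys j → uniq (χ C (ys j) (xs i)) ≡ true → Code i j j (suc (m ↑ʳ χ C (ys j) (xs i)))

    code : ∀ i j → ∃ λ k → ∃ λ l → Code i j k l
    code i j with xs i ≟ ys j
    ... | yes r = _ , _ , same r
    ... | no ¬r with pair i j ¬r
    ...   | inj₁ u = _ , _ , outx ¬r u
    ...   | inj₂ u = _ , _ , outy ¬r u

    ↑ˡ≢↑ʳ : ∀ (k k′ : Fin m) → k ↑ˡ m ≢ m ↑ʳ k′
    ↑ˡ≢↑ʳ k k′ r with () ← trans (sym (Finₚ.splitAt-↑ˡ m k m)) (trans (cong (splitAt m) r) (Finₚ.splitAt-↑ʳ m m k′))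

    code-inj : ∀ {i j i′ j′ k l k′ l′} → Code i j k l → Code i′ j′ k′ l′ → k ≡ k′ → l ≡ l′ → i ≡ i′ × j ≡ j′
    code-inj (same r) (same r′) refl _ = refl , ys-inj _ _ (trans (sym r) r′)
    code-inj (outx h u) (outx h′ u′) refl q =
      refl , ys-inj _ _ (χ-unique C h h′ u (Finₚ.↑ˡ-injective m _ _ (Finₚ.suc-injective q)))
    code-inj (outy h u) (outy h′ u′) refl q =
      xs-inj _ _ (χ-unique C (h ∘ sym) (h′ ∘ sym) u (Finₚ.↑ʳ-injective m _ _ (Finₚ.suc-injective q))) , refl
    code-inj (outx _ _) (outy _ _) _ q = ⊥-elim (↑ˡ≢↑ʳ _ _ (Finₚ.suc-injective q))
    code-inj (outy _ _) (outx _ _) _ q = ⊥-elim (↑ˡ≢↑ʳ _ _ (sym (Finₚ.suc-injective q)))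

    f : Fin (s * s) → Fin (s * suc (m + m))
    f z = let i , j = remQuot {s} s z ; k , l , _ = code i j in combine k l

    f-inj : ∀ {z z′} → f z ≡ f z′ → z ≡ z′
    f-inj {z} {z′} r =
      let i , j = remQuot {s} s z ; i′ , j′ = remQuot {s} s z′
          k , l , e = code i j ; k′ , l′ , e′ = code i′ j′
          p , q = Finₚ.combine-injective k l k′ l′ r
          p′ , q′ = code-inj e e′ p q
      in trans (sym (Finₚ.combine-remQuot {s} s z)) (trans (cong₂ combine p′ q′) (Finₚ.combine-remQuot {s} s z′))

    square : s * s ≤ s * suc (m + m)
    square = Finₚ.injective⇒≤ f-inj

  -- Take `2 + (m + m)` members of each group. If every edge between them were unique at some end,
  -- `square` would give `2 + (m + m) ≤ suc (m + m)`. A colour unique at neither end belongs to all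
  -- palettes of a group or to none, so it also serves `v` and `w`.
  large-groups-compat : ∀ {n} {lab : Fin n → Fin P} → Colouring lab → ∀ v w →
    2 + (m + m) ≤ size lab (grp (lab v)) → 2 + (m + m) ≤ size lab (grp (lab w)) → Compat (lab v) (lab w)
  large-groups-compat {n} {lab} C v w hv hw with compat? (lab v) (lab w)
  ... | yes c = c
  ... | no ¬c = ⊥-elim (contra (enumerate (2 + (m + m)) _ hv) (enumerate (2 + (m + m)) _ hw))
    where
    contra : Σ (Fin (2 + (m + m)) → Fin n) (λ e → (∀ i → (grp (lab (e i)) == grp (lab v)) ≡ true) × (∀ i j → e i ≡ e j → i ≡ j)) →
             Σ (Fin (2 + (m + m)) → Fin n) (λ e → (∀ i → (grp (lab (e i)) == grp (lab w)) ≡ true) × (∀ i j → e i ≡ e j → i ≡ j)) → ⊥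
    contra (xs , gx , xs-inj) (ys , gy , ys-inj) =
      <-irrefl refl (*-cancelˡ-≤ {2 + (m + m)} {suc (m + m)} (2 + (m + m)) (FewPairs.square C (2 + (m + m)) xs ys xs-inj ys-inj pair))
      where
      pair : ∀ i j → xs i ≢ ys j → uniq (χ C (xs i) (ys j)) ≡ true ⊎ uniq (χ C (ys j) (xs i)) ≡ true
      pair i j h with bool? (uniq (χ C (xs i) (ys j))) | bool? (uniq (χ C (ys j) (xs i)))
      ... | inj₁ u | _       = inj₁ u
      ... | inj₂ _ | inj₁ u  = inj₂ u
      ... | inj₂ u | inj₂ u′ = ⊥-elim (¬c (d , u , u″ ,
              trans (sym (grp-mem (lab (xs i)) (lab v) d (==⇒≡ _ _ (gx i)) u)) (χ-mem C h) ,
              trans (sym (grp-mem (lab (ys j)) (lab w) (rev d) (==⇒≡ _ _ (gy j)) u″))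
                (subst (λ z → mem (lab (ys j)) z ≡ true) (χ-sym C h) (χ-mem C (h ∘ sym)))))
        where
        d = χ C (xs i) (ys j)
        u″ : uniq (rev d) ≡ false
        u″ = trans (cong uniq (sym (χ-sym C h))) u′

  -- The potential and its decrease

  cap : ℕ → ℕ → ℕ
  cap zero    b = 0
  cap (suc _) b = b ⊓ suc threshold

  cap-mono : ∀ {a a′ b b′} → a ≤ a′ → b ≤ b′ → cap a b ≤ cap a′ b′
  cap-mono z≤n     h′ = z≤n
  cap-mono (s≤s h) h′ = ⊓-monoˡ-≤ (suc threshold) h′

  cap-mono-< : ∀ {a a′ b b′} → 0 < a′ → a ≤ a′ → b < b′ → b′ ≤ threshold → cap a b < cap a′ b′
  cap-mono-< {a} {suc a′} {b} {b′} _ h h′ le = ≤-trans (s≤s (≤-trans (cap-≤ a) (m⊓n≤m b _)))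
    (≤-trans h′ (≤-reflexive (sym (m≤n⇒m⊓n≡m (≤-trans le (n≤1+n _))))))
    where
    cap-≤ : ∀ a → cap a b ≤ b ⊓ suc threshold
    cap-≤ zero    = z≤n
    cap-≤ (suc _) = ≤-refl

  -- Each summand is truncated where its condition is met: `suc threshold` ends suffice for a colour
  -- in use, and `2 + (m + m)` members make a group large. A removal that repairs a scarcity
  -- strictly lowers an untruncated summand.
  Φ₁ Φ₂ Φ : ∀ {n} → (Fin n → Fin P) → ℕ
  Φ₁ lab = ∑ (λ c → cap (deg lab c) (deg lab (rev c)))
  Φ₂ lab = ∑ (λ g → size lab g ⊓ (2 + (m + m)))
  Φ lab = Φ₁ lab + Φ₂ lab

  bound-Φ : ℕ
  bound-Φ = m * suc threshold + G * (2 + (m + m))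

  Φ≤bound : ∀ {n} (lab : Fin n → Fin P) → Φ lab ≤ bound-Φ
  Φ≤bound lab = +-mono-≤ (∑-bound (λ c → cap (deg lab c) (deg lab (rev c))) (suc threshold) λ c → cap≤ (deg lab c) (deg lab (rev c)))
                         (∑-bound (λ g → size lab g ⊓ (2 + (m + m))) (2 + (m + m)) λ g → m⊓n≤n (size lab g) _)
    where
    cap≤ : ∀ a b → cap a b ≤ suc threshold
    cap≤ zero    b = z≤n
    cap≤ (suc _) b = m⊓n≤n b _

  module Remove {n : ℕ} {lab : Fin (suc n) → Fin P} (C : Colouring lab) (a : Fin (suc n)) where

    ι : Fin n → Fin (suc n)
    ι = punchIn a

    ι≢a : ∀ v → ι v ≢ a
    ι≢a v = Finₚ.punchInᵢ≢i a v

    ι-≢ : ∀ {v w} → v ≢ w → ι v ≢ ι w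
    ι-≢ h r = h (Finₚ.punchIn-injective a _ _ r)

    kind : Fin n → Fin (P * m)
    kind v = combine (lab (ι v)) (χ C (ι v) a)

    pal-kind : ∀ v → pal (kind v) ≡ lab (ι v)
    pal-kind v = pal-combine (lab (ι v)) (χ C (ι v) a)

    col-kind : ∀ v → col (kind v) ≡ χ C (ι v) a
    col-kind v = col-combine (lab (ι v)) (χ C (ι v) a)

    lab′ : Fin n → Fin P
    lab′ v = res (kind v)

    lab′≡ : ∀ v → lab′ v ≡ upd (lab (ι v)) (χ C (ι v) a)
    lab′≡ v = cong₂ upd (pal-kind v) (col-kind v)

    mem-lab′ : ∀ v d → mem (lab′ v) d ≡ mem (lab (ι v)) d ∧ not (uniq d ∧ (χ C (ι v) a == d))
    mem-lab′ v d = trans (cong (λ q → mem q d) (lab′≡ v)) (mem-upd _ _ d)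

    -- If the edge from `ι v` to `a` has a unique colour, no other edge at `ι v` has it. Dropping it
    -- from the palette thus leaves the surviving edges legal and every remaining unique colour
    -- witnessed.
    colouring : Colouring lab′
    colouring = record
      { χ        = λ v w → χ C (ι v) (ι w)
      ; χ-sym    = λ h → χ-sym C (ι-≢ h)
      ; χ-mem    = λ {v} {w} h → trans (mem-lab′ v _) (∧-intro (χ-mem C (ι-≢ h)) (not-false (other v w h)))
      ; χ-exists = λ {v} {c} → ex v c
      ; χ-unique = λ h h′ u r → Finₚ.punchIn-injective a _ _ (χ-unique C (ι-≢ h) (ι-≢ h′) u r)
      }
      where
      other : ∀ v w → v ≢ w → uniq (χ C (ι v) (ι w)) ∧ (χ C (ι v) a == χ C (ι v) (ι w)) ≡ false
      other v w h with bool? (uniq (χ C (ι v) (ι w)) ∧ (χ C (ι v) a == χ C (ι v) (ι w)))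
      ... | inj₂ r = r
      ... | inj₁ r with ∧-true {uniq (χ C (ι v) (ι w))} r
      ...   | u , q = ⊥-elim (ι≢a w (χ-unique C (ι-≢ h) (ι≢a v) u (sym (==⇒≡ _ _ q))))
      ex : ∀ v c → uniq c ≡ true → mem (lab′ v) c ≡ true → ∃ λ w → v ≢ w × χ C (ι v) (ι w) ≡ c
      ex v c u mc with ∧-true {mem (lab (ι v)) c} (trans (sym (mem-lab′ v c)) mc)
      ... | mc′ , nk with χ-exists C {ι v} u mc′
      ...   | b , v≢b , e with a ≟ b
      ...     | yes refl = ⊥-elim (true≢false (∧-intro u (trans (cong (_== c) e) (==-refl c))) (not-true nk))
      ...     | no a≢b = punchOut a≢b , (λ r → v≢b (trans (cong ι r) (Finₚ.punchIn-punchOut a≢b)))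
                         , trans (cong (χ C (ι v)) (Finₚ.punchIn-punchOut a≢b)) e

    king : ∀ (x x′ : Fin P → ℕ) (y : Fin (P * m) → ℕ) → (∀ p → x p ≡ cnt-label lab p) →
      (∀ p → x′ p ≡ cnt-label lab′ p) → (∀ z → y z ≡ cnt-label kind z) → King x x′ y (lab a)
    king x x′ y hx hx′ hy =
      (λ p → trans (hx p) (trans (count-punchIn (λ v → lab v == p) a) (cong (b2n (lab a == p) +_)
               (trans (count-cong λ v → cong (_== p) (sym (pal-kind v))) (push (λ z → pal z == p)))))) ,
      legal , once ,
      λ q → trans (hx′ q) (push (λ z → res z == q))
      where
      push : ∀ g → countTrue (λ v → g (kind v)) ≡ sumWhere g y
      push g = trans (count-label g kind) (sumWhere-cong g (λ z → sym (hy z)))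
      legal : ∀ z → y z ≡ 0 ⊎ (mem (pal z) (col z) ≡ true × mem (lab a) (rev (col z)) ≡ true)
      legal z with y z ℕₚ.≟ 0
      ... | yes r = inj₁ r
      ... | no ¬r with count-pos (λ v → kind v == z) (subst (0 <_) (hy z) (n≢0⇒n>0 ¬r))
      ...   | v , e with ==⇒≡ (kind v) z e
      ...     | refl = inj₂ (subst₂ (λ p c → mem p c ≡ true) (sym (pal-kind v)) (sym (col-kind v)) (χ-mem C (ι≢a v)) ,
                 subst (λ c → mem (lab a) c ≡ true) (trans (χ-sym C (ι≢a v)) (cong rev (sym (col-kind v)))) (χ-mem C (ι≢a v ∘ sym)))
      once : ∀ c → uniq c ≡ false ⊎ mem (lab a) c ≡ false ⊎ sumWhere (λ z → col z == rev c) y ≡ 1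
      once c with bool? (uniq c) | bool? (mem (lab a) c)
      ... | inj₂ f | _ = inj₁ f
      ... | inj₁ _ | inj₂ f = inj₂ (inj₁ f)
      ... | inj₁ u | inj₁ mc with χ-exists C u mc
      ...   | b , a≢b , e = inj₂ (inj₂ (trans (sym (push (λ z → col z == rev c)))
                (count-unique (λ v → col (kind v) == rev c) {punchOut a≢b} at only)))
        where
        ιb : ι (punchOut a≢b) ≡ b
        ιb = Finₚ.punchIn-punchOut a≢b
        at : (col (kind (punchOut a≢b)) == rev c) ≡ true
        at = trans (cong (_== rev c) (trans (col-kind _) (trans (cong (λ t → χ C t a) ιb)
               (trans (χ-sym C a≢b) (cong rev e))))) (==-refl (rev c))
        only : ∀ w → (col (kind w) == rev c) ≡ true → punchOut a≢b ≡ w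
        only w q = Finₚ.punchIn-injective a _ _ (trans ιb (χ-unique C a≢b (ι≢a w ∘ sym)
          (trans (cong uniq e) u) (trans e (trans (sym (rev-rev c))
            (trans (cong rev (trans (sym (==⇒≡ _ _ q)) (col-kind w))) (sym (χ-sym C (ι≢a w))))))))

    deg-lab : ∀ c → deg lab c ≡ b2n (mem (lab a) c) + countTrue (λ v → mem (lab (ι v)) c)
    deg-lab c = count-punchIn (λ v → mem (lab v) c) a

    deg-ι : ∀ c → deg lab′ c ≤ countTrue (λ v → mem (lab (ι v)) c)
    deg-ι c = count-mono λ v h → proj₁ (∧-true (trans (sym (mem-lab′ v c)) h))

    deg-≤ : ∀ c → deg lab′ c ≤ deg lab c
    deg-≤ c = ≤-trans (deg-ι c) (≤-trans (m≤n+m _ (b2n (mem (lab a) c))) (≤-reflexive (sym (deg-lab c))))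

    deg-< : ∀ c → mem (lab a) c ≡ true → deg lab′ c < deg lab c
    deg-< c h = ≤-trans (s≤s (deg-ι c)) (≤-reflexive (sym (trans (deg-lab c) (cong (λ b → b2n b + countTrue (λ v → mem (lab (ι v)) c)) h))))

    size-lab : ∀ g → size lab g ≡ b2n (grp (lab a) == g) + size lab′ g
    size-lab g = trans (count-punchIn (λ v → grp (lab v) == g) a) (cong (b2n (grp (lab a) == g) +_)
      (count-cong λ v → cong (_== g) (trans (sym (grp-upd _ _)) (cong grp (sym (lab′≡ v))))))

    size-≤ : ∀ g → size lab′ g ≤ size lab g
    size-≤ g = ≤-trans (m≤n+m _ (b2n (grp (lab a) == g))) (≤-reflexive (sym (size-lab g)))

    Φ₁-≤ : Φ₁ lab′ ≤ Φ₁ lab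
    Φ₁-≤ = ∑-mono λ c → cap-mono (deg-≤ c) (deg-≤ (rev c))

    Φ₂-≤ : Φ₂ lab′ ≤ Φ₂ lab
    Φ₂-≤ = ∑-mono λ g → ⊓-monoˡ-≤ _ (size-≤ g)

    Φ-colour : ∀ c → 0 < deg lab c → mem (lab a) (rev c) ≡ true → deg lab (rev c) ≤ threshold → Φ lab′ < Φ lab
    Φ-colour c pos h le = +-mono-<-≤ (∑-mono-< (λ d → cap-mono (deg-≤ d) (deg-≤ (rev d))) c
      (cap-mono-< pos (deg-≤ c) (deg-< (rev c) h) le)) Φ₂-≤

    Φ-group : size lab (grp (lab a)) < 2 + (m + m) → Φ lab′ < Φ lab
    Φ-group lt = +-mono-≤-< Φ₁-≤ (∑-mono-< (λ g → ⊓-monoˡ-≤ _ (size-≤ g)) (grp (lab a))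
      (≤-trans (s≤s (m⊓n≤m _ _)) (≤-trans (≤-reflexive (sym (trans (size-lab (grp (lab a)))
         (cong (λ b → b2n b + size lab′ (grp (lab a))) (==-refl (grp (lab a)))))))
         (≤-reflexive (sym (m≤n⇒m⊓n≡m (<⇒≤ lt)))))))

  -- Following the `c`-edge leads to a vertex with `rev c` in its palette, and uniqueness of `rev c`
  -- there makes this map injective.
  balanced : ∀ {n} {lab : Fin n → Fin P} → Colouring lab → ∀ c → uniq c ≡ true → uniq (rev c) ≡ true →
    deg lab c ≤ deg lab (rev c)
  balanced {lab = lab} C c u u′ = count-inj _ _ (λ v mv → proj₁ (χ-exists C u mv))
    (λ v mv → let w , v≢w , e = χ-exists C u mv
              in subst (λ d → mem (lab w) d ≡ true) (trans (χ-sym C v≢w) (cong rev e)) (χ-mem C (v≢w ∘ sym)))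
    λ v v′ mv mv′ r → let w , v≢w , e = χ-exists C u mv
                          w′ , v′≢w′ , e′ = χ-exists C u mv′
                          back = trans (χ-sym C v≢w) (cong rev e)
                      in χ-unique C (v≢w ∘ sym) (λ q → v′≢w′ (trans (sym q) r)) (trans (cong uniq back) u′)
                           (trans back (sym (trans (cong (λ t → χ C t v′) r) (trans (χ-sym C v′≢w′) (cong rev e′)))))

  -- Of two incompatible vertices one lies in a small group, by `large-groups-compat`. A unique
  -- colour in use with few possible other ends has at least one actual other end. Either vertex can
  -- be removed with profit; failing both, the counts are nice.
  removable : ∀ {n} {lab : Fin n → Fin P} (C : Colouring lab) →
    Nice (cnt-label lab) ⊎
    (∃ λ a → (∃ λ c → 0 < deg lab c × mem (lab a) (rev c) ≡ true × deg lab (rev c) ≤ threshold)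
             ⊎ size lab (grp (lab a)) < 2 + (m + m))
  removable {n} {lab} C
    with Finₚ.any? (λ v → Finₚ.any? λ w → ¬? (v ≟ w) ×-dec ¬? (compat? (lab v) (lab w)))
       | Finₚ.any? (λ c → (uniq c Boolₚ.≟ true) ×-dec (0 <? deg lab c) ×-dec (deg lab (rev c) ≤? threshold))
  ... | yes (v , w , v≢w , ¬c) | _ with suc (size lab (grp (lab v))) ≤? 2 + (m + m) | suc (size lab (grp (lab w))) ≤? 2 + (m + m)
  ...   | yes lt | _ = inj₂ (v , inj₂ lt)
  ...   | no _ | yes lt = inj₂ (w , inj₂ lt)
  ...   | no h | no h′ = ⊥-elim (¬c (large-groups-compat C v w (≮⇒≥ h) (≮⇒≥ h′)))
  removable {n} {lab} C | no _ | yes (c , u , pos , le)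
    with count-pos (λ v → mem (lab v) c) pos
  ... | v , mv with χ-exists C u mv
  ...   | a , v≢a , e = inj₂ (a , inj₁ (c , pos ,
            subst (λ d → mem (lab a) d ≡ true) (trans (χ-sym C v≢a) (cong rev e)) (χ-mem C (v≢a ∘ sym)) , le))
  removable {n} {lab} C | no h | no h′ = inj₁ (nice₁ , nice₂)
    where
    x = cnt-label lab
    deg-total : ∀ c → deg lab c ≡ total x c
    deg-total c = count-label (λ p → mem p c) lab
    nice₁ : ∀ p q → Compat p q ⊎ x p ≡ 0 ⊎ x q ≡ 0 ⊎ (p ≡ q × x p ≤ 1)
    nice₁ p q with compat? p q | x p ℕₚ.≟ 0 | x q ℕₚ.≟ 0
    ... | yes c | _ | _ = inj₁ c
    ... | no _ | yes r | _ = inj₂ (inj₁ r)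
    ... | no _ | no _ | yes r = inj₂ (inj₂ (inj₁ r))
    ... | no ¬c | no ¬p | no ¬q
      with count-pos (λ v → lab v == p) (n≢0⇒n>0 ¬p) | count-pos (λ v → lab v == q) (n≢0⇒n>0 ¬q)
    ...   | v , ev | w , ew with ==⇒≡ (lab v) p ev | ==⇒≡ (lab w) q ew | p ≟ q
    ...     | refl | refl | no p≢q = ⊥-elim (h (v , w , (λ { refl → p≢q refl }) , ¬c))
    ...     | refl | refl | yes r with x (lab v) ≤? 1
    ...       | yes le = inj₂ (inj₂ (inj₂ (r , le)))
    ...       | no ¬le with enumerate 2 (λ u → lab u == lab v) (≰⇒> ¬le)
    ...         | e , le , inj = ⊥-elim (h (e zero , e (suc zero) , (λ q → 0≢1 (inj _ _ q)) ,
                    subst₂ (λ s t → ¬ Compat s t) (sym (==⇒≡ _ _ (le zero)))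
                      (trans (sym r) (sym (==⇒≡ _ _ (le (suc zero))))) ¬c))
      where
      0≢1 : Fin.zero {1} ≢ suc zero
      0≢1 ()
    nice₂ : ∀ c → uniq c ≡ false ⊎ total x c ≡ 0 ⊎
      (suc threshold ≤ total x (rev c) × (uniq (rev c) ≡ false ⊎ total x c ≡ total x (rev c)))
    nice₂ c with bool? (uniq c) | deg lab c ℕₚ.≟ 0
    ... | inj₂ f | _ = inj₁ f
    ... | inj₁ _ | yes z = inj₂ (inj₁ (trans (sym (deg-total c)) z))
    ... | inj₁ u | no ¬z = inj₂ (inj₂ (subst (suc threshold ≤_) (deg-total (rev c))
                             (≰⇒> λ le → h′ (c , u , n≢0⇒n>0 ¬z , le)) , bal (bool? (uniq (rev c)))))
      where
      bal : _ → uniq (rev c) ≡ false ⊎ total x c ≡ total x (rev c)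
      bal (inj₂ f)  = inj₁ f
      bal (inj₁ u′) = inj₂ (trans (sym (deg-total c)) (trans
        (≤-antisym (balanced C c u u′)
          (≤-trans (balanced C (rev c) u′ (trans (cong uniq (rev-rev c)) u)) (≤-reflexive (cong (deg lab) (rev-rev c)))))
        (deg-total (rev c))))

  -- `B` is fuel dominating the potential: each removal consumes one unit and lowers `Φ`, so a
  -- reducible situation never meets `B = 0`.
  coloured⇒reducible : ∀ B {n} {lab : Fin n → Fin P} → Colouring lab → ∀ x → (∀ p → x p ≡ cnt-label lab p) →
    Φ lab ≤ B → Reducible B x
  coloured⇒reducible B {n} {lab} C x hx le with removable C
  ... | inj₁ nice = nice⇒reducible B x (Nice-cong (λ p → sym (hx p)) nice)
  coloured⇒reducible B {suc n} {lab} C x hx le | inj₂ (a , why) = go B (≤-trans (lower why) le)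
    where
    open Remove C a
    lower : _ → Φ lab′ < Φ lab
    lower (inj₁ (c , pos , mc , small)) = Φ-colour c pos mc small
    lower (inj₂ small) = Φ-group small
    go : ∀ B → Φ lab′ < B → Reducible B x
    go (suc B) (s≤s le′) = tabulate (cnt-label lab′) , tabulate (cnt-label kind) ,
      inj₂ (lab a , king x _ _ hx (lookup∘tabulate _) (lookup∘tabulate _)) ,
      coloured⇒reducible B colouring _ (lookup∘tabulate _) le′

  -- The spectrum in terms of palette counts

  module Spectrum (Ok : Fin P → Set) (ok? : ∀ p → Dec (Ok p)) where

    Spec : ℕ → Set
    Spec n = Σ (Fin n → Fin P) λ lab → (∀ v → Ok (lab v)) × Colouring lab

    -- `Ok` is imposed on the original palettes only: residual palettes have lost colours and no
    -- longer reflect the counting conditions.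
    CountSpec : ℕ → Set
    CountSpec n = Σ (Vec ℕ P) λ x →
      (∑ (lookup x) ≡ n × (∀ p → lookup x p ≡ 0 ⊎ Ok p)) × Reducible bound-Φ (lookup x)

    countSpecD : ∀ {M} {E : Set} {e : E → Vec ℕ M} {f : E → ℕ} → TermFor e f → Defn e (λ ε → CountSpec (f ε))
    countSpecD t = ΣD (DecDefn.defn ((∑T newVarT ≡D weakenT t) ×D (∀D λ p → (newVarT p ≡D constT 0) ⊎D static (ok? p)))
                        ∩ ReducibleD bound-Φ newVarT)

    count⇒spec : ∀ n → CountSpec n → Spec n
    count⇒spec n (x , (sum , ok) , red) with reducible⇒realisable bound-Φ (lookup x) red
    ... | n′ , lab , num , C with trans (sym (∑-cnt-label lab)) (trans (∑-cong num) sum)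
    ...   | refl = lab , oks , C
      where
      oks : ∀ v → Ok (lab v)
      oks v with ok (lab v)
      ... | inj₂ o = o
      ... | inj₁ z = ⊥-elim (<-irrefl (sym (trans (num (lab v)) z)) (count-witness (λ w → lab w == lab v) (==-refl (lab v))))

    spec⇒count : ∀ n → Spec n → CountSpec n
    spec⇒count n (lab , oks , C) = tabulate (cnt-label lab) ,
      (trans (∑-cong (lookup∘tabulate (cnt-label lab))) (∑-cnt-label lab) , ok) ,
      coloured⇒reducible bound-Φ C _ (lookup∘tabulate (cnt-label lab)) (Φ≤bound lab)
      where
      ok : ∀ p → lookup (tabulate (cnt-label lab)) p ≡ 0 ⊎ Ok p
      ok p with cnt-label lab p ℕₚ.≟ 0
      ... | yes z = inj₁ (trans (lookup∘tabulate (cnt-label lab) p) z)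
      ... | no ¬z with count-pos (λ v → lab v == p) (n≢0⇒n>0 ¬z)
      ...   | v , e = inj₂ (subst Ok (==⇒≡ (lab v) p e) (oks v))

-- Boolean comparison of numbers

≤ᵇ-true : ∀ {k w} → (k ≤ᵇ w) ≡ true → k ≤ w
≤ᵇ-true {k} {w} e = ≤ᵇ⇒≤ k w (subst T (sym e) tt)

true-≤ᵇ : ∀ {k w} → k ≤ w → (k ≤ᵇ w) ≡ true
true-≤ᵇ le = Equivalence.to Boolₚ.T-≡ (≤⇒≤ᵇ le)

≤ᵇ-false : ∀ {k w} → (k ≤ᵇ w) ≡ false → w < k
≤ᵇ-false e = ≰⇒> λ le → true≢false (true-≤ᵇ le) e

false-≤ᵇ : ∀ {k w} → w < k → (k ≤ᵇ w) ≡ false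
false-≤ᵇ {k} {w} lt with bool? (k ≤ᵇ w)
... | inj₂ e = e
... | inj₁ e = ⊥-elim (<-irrefl refl (≤-trans lt (≤ᵇ-true e)))

<ᵇ-true : ∀ {k w} → (k <ᵇ w) ≡ true → k < w
<ᵇ-true {k} {w} e = <ᵇ⇒< k w (subst T (sym e) tt)

true-<ᵇ : ∀ {k w} → k < w → (k <ᵇ w) ≡ true
true-<ᵇ lt = Equivalence.to Boolₚ.T-≡ (<⇒<ᵇ lt)

<ᵇ-flip : ∀ {n} (a b : Fin n) → a ≢ b → (toℕ b <ᵇ toℕ a) ≡ not (toℕ a <ᵇ toℕ b)
<ᵇ-flip zero    zero    h = ⊥-elim (h refl)
<ᵇ-flip zero    (suc b) h = refl
<ᵇ-flip (suc a) zero    h = refl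
<ᵇ-flip (suc a) (suc b) h = <ᵇ-flip a b (h ∘ cong suc)

-- From counting conditions to palettes

record Code (A : Set) : Set where
  field
    card    : ℕ
    enc     : A → Fin card
    dec     : Fin card → A
    dec-enc : ∀ a → dec (enc a) ≡ a
    enc-dec : ∀ i → enc (dec i) ≡ i

  enc-injective : ∀ {a b} → enc a ≡ enc b → a ≡ b
  enc-injective {a} {b} e = trans (sym (dec-enc a)) (trans (cong dec e) (dec-enc b))

  infix 4 _≟ᶜ_
  _≟ᶜ_ : (a b : A) → Dec (a ≡ b)
  a ≟ᶜ b = map′ enc-injective (cong enc) (enc a ≟ enc b)
open Code

code-Fin : ∀ n → Code (Fin n)
code-Fin n = record { card = n ; enc = λ i → i ; dec = λ i → i ; dec-enc = λ _ → refl ; enc-dec = λ _ → refl }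

code-⊤ : Code ⊤
code-⊤ = record { card = 1 ; enc = λ _ → zero ; dec = λ _ → tt ; dec-enc = λ _ → refl ; enc-dec = λ { zero → refl } }

code-Bool : Code Bool
code-Bool = record
  { card    = 2
  ; enc     = λ { false → zero ; true → suc zero }
  ; dec     = λ { zero → false ; (suc zero) → true }
  ; dec-enc = λ { false → refl ; true → refl }
  ; enc-dec = λ { zero → refl ; (suc zero) → refl } }

infixr 2 _code-×_
_code-×_ : ∀ {A B} → Code A → Code B → Code (A × B)
cA code-× cB = record
  { card    = card cA * card cB
  ; enc     = λ (a , b) → combine (enc cA a) (enc cB b)
  ; dec     = λ i → let j , k = remQuot {card cA} (card cB) i in dec cA j , dec cB k
  ; dec-enc = λ (a , b) → trans (cong (λ (j , k) → dec cA j , dec cB k) (Finₚ.remQuot-combine (enc cA a) (enc cB b)))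
                                (cong₂ _,_ (dec-enc cA a) (dec-enc cB b))
  ; enc-dec = λ i → trans (cong₂ combine (enc-dec cA _) (enc-dec cB _)) (Finₚ.combine-remQuot {card cA} (card cB) i) }

fromSet : ∀ {m} → (Fin m → Bool) → Fin (2 ^ m)
fromSet f = funToFin (λ c → enc code-Bool (f c))

toSet : ∀ {m} → Fin (2 ^ m) → Fin m → Bool
toSet p c = dec code-Bool (finToFun p c)

toSet-fromSet : ∀ {m} (f : Fin m → Bool) c → toSet (fromSet f) c ≡ f c
toSet-fromSet f c = trans (cong (dec code-Bool) (Finₚ.finToFun-funToFin (λ c → enc code-Bool (f c)) c)) (dec-enc code-Bool (f c))

fromSet-cong : ∀ {m} {f g : Fin m → Bool} → (∀ c → f c ≡ g c) → fromSet f ≡ fromSet g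
fromSet-cong {zero}  h = refl
fromSet-cong {suc m} h = cong₂ combine (cong (enc code-Bool) (h zero)) (fromSet-cong (h ∘ suc))

-- One counting condition, relative to a vertex of type `A`: `bit` is the claimed truth value,
-- `self` the contribution of the vertex itself, and `β` decides another vertex from both types and
-- the relations in both directions.
record Node (A R : Set) : Set where
  field
    k    : ℕ
    bit  : A → Bool
    self : A → Bool
    β    : A → R → R → A → Bool
open Node

module _ {A R : Set} {n : ℕ} (t : Fin n → A) (r : Fin n → Fin n → R) where

  holds : Node A R → Fin n → Fin n → Bool
  holds nd a b = not (a == b) ∧ β nd (t a) (r a b) (r b a) (t b)

  NodeOk : Fin n → Node A R → Set
  NodeOk a nd = bit nd (t a) ≡ (k nd ≤ᵇ (b2n (self nd (t a)) + countTrue (holds nd a)))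

module NormalForm {A R : Set} (codeA : Code A) (codeR : Code R) (a₀ : A) (r₀ : R)
  (nodes : List (Node A R)) (root : A → Bool) where

  -- `root` is demanded at every vertex, since a sentence has the same value wherever it is read
  -- off. On an empty domain the demand is vacuous, so size 0 needs separate treatment.
  Model : ℕ → Set
  Model n = Σ (Fin n → A) λ t → Σ (Fin n → Fin n → R) λ r →
    ∀ a → root (t a) ≡ true × All (NodeOk t r a) nodes

  max-k : List (Node A R) → ℕ
  max-k []       = 0
  max-k (nd ∷ l) = k nd ⊔ max-k l

  K : ℕ
  K = max-k nodes

  k≤K : All (λ nd → k nd ≤ K) nodes
  k≤K = go nodes
    where
    go : ∀ l → All (λ nd → k nd ≤ max-k l) l
    go []       = []
    go (nd ∷ l) = m≤m⊔n (k nd) (max-k l) ∷ All.map (λ le → ≤-trans le (m≤n⊔m (k nd) (max-k l))) (go l)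

  -- The index of a half-edge numbers the first K neighbours of its class, and is K for all the others.
  Half : Set
  Half = A × R × Fin (suc K)

  -- The Boolean records the order of the end points, so that no colour is its own reverse.
  Colour : Set
  Colour = Half × Half × Bool

  revC : Colour → Colour
  revC (h , h′ , b) = h′ , h , not b

  revC≢ : ∀ c → revC c ≢ c
  revC≢ (_ , _ , true)  ()
  revC≢ (_ , _ , false) ()

  uniqC : Colour → Bool
  uniqC ((_ , _ , i) , _) = toℕ i <ᵇ K

  srcC : Colour → A
  srcC ((x , _) , _) = x

  βC : Node A R → Colour → Bool
  βC nd ((x , r , _) , (x′ , r′ , _) , _) = β nd x r r′ x′

  codeC : Code Colour
  codeC = (codeA code-× codeR code-× code-Fin (suc K)) code-× (codeA code-× codeR code-× code-Fin (suc K)) code-× code-Bool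

  abstract
    m : ℕ
    m = card codeC

    encC : Colour → Fin m
    encC = enc codeC

    decC : Fin m → Colour
    decC = dec codeC

    decC-encC : ∀ c → decC (encC c) ≡ c
    decC-encC = dec-enc codeC

    encC-decC : ∀ i → encC (decC i) ≡ i
    encC-decC = enc-dec codeC

  encC-injective : ∀ {c d} → encC c ≡ encC d → c ≡ d
  encC-injective {c} {d} e = trans (sym (decC-encC c)) (trans (cong decC e) (decC-encC d))

  rev : Fin m → Fin m
  rev c = encC (revC (decC c))

  rev-encC : ∀ c → rev (encC c) ≡ encC (revC c)
  rev-encC c = cong (encC ∘ revC) (decC-encC c)

  revC-revC : ∀ c → revC (revC c) ≡ c
  revC-revC (h , h′ , true)  = refl
  revC-revC (h , h′ , false) = refl

  rev-rev : ∀ c → rev (rev c) ≡ c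
  rev-rev c = trans (rev-encC (revC (decC c))) (trans (cong encC (revC-revC (decC c))) (encC-decC c))

  rev≢ : ∀ c → rev c ≢ c
  rev≢ c e = revC≢ (decC c) (trans (sym (decC-encC _)) (cong decC e))

  uniq : Fin m → Bool
  uniq c = uniqC (decC c)

  mem : Fin (2 ^ m) → Fin m → Bool
  mem = toSet

  upd : Fin (2 ^ m) → Fin m → Fin (2 ^ m)
  upd p c = fromSet (λ d → mem p d ∧ not (uniq d ∧ (c == d)))

  mem-upd : ∀ p c d → mem (upd p c) d ≡ mem p d ∧ not (uniq d ∧ (c == d))
  mem-upd p c d = toSet-fromSet _ d

  grp : Fin (2 ^ m) → Fin (2 ^ m)
  grp p = fromSet (λ d → mem p d ∧ not (uniq d))

  grp-upd : ∀ p c → grp (upd p c) ≡ grp p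
  grp-upd p c = fromSet-cong λ d → trans (cong (_∧ not (uniq d)) (mem-upd p c d)) (absorb (mem p d) (uniq d) (c == d))
    where
    absorb : ∀ x y z → (x ∧ not (y ∧ z)) ∧ not y ≡ x ∧ not y
    absorb false y     z = refl
    absorb true  false z = refl
    absorb true  true  z = Boolₚ.∧-zeroʳ (not z)

  grp-mem : ∀ p q d → grp p ≡ grp q → uniq d ≡ false → mem p d ≡ mem q d
  grp-mem p q d e u = trans (sym (via p)) (trans (cong (λ g → mem g d) e) (via q))
    where
    via : ∀ p → mem (grp p) d ≡ mem p d
    via p = trans (toSet-fromSet _ d) (trans (cong (λ b → mem p d ∧ not b) u) (Boolₚ.∧-identityʳ (mem p d)))

  c₀ : Fin m
  c₀ = encC ((a₀ , r₀ , zero) , (a₀ , r₀ , zero) , false)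

  open Palettes m c₀ rev rev-rev rev≢ uniq (2 ^ m) mem using (Colouring) public
  open Colouring
  private module Core = Kings m c₀ rev rev-rev rev≢ uniq (2 ^ m) mem upd mem-upd (2 ^ m) grp grp-upd grp-mem

  fits : Node A R → Fin (2 ^ m) → Fin m → Bool
  fits nd p c = mem p c ∧ (uniq c ∧ βC nd (decC c))

  weight : Node A R → A → Fin (2 ^ m) → ℕ
  weight nd x p = b2n (self nd x) + countTrue (fits nd p)

  -- A true condition is witnessed by unique colours alone, because an overflowing class has `K` of
  -- them and `k nd ≤ K`. A false one admits no satisfying non-unique colour, so the unique colours
  -- then count the witnesses exactly.
  NodeAllowed : A → Fin (2 ^ m) → Node A R → Set
  NodeAllowed x p nd =
    (bit nd x ≡ true × k nd ≤ weight nd x p) ⊎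
    (bit nd x ≡ false × weight nd x p < k nd × (∀ c → mem p c ∧ (not (uniq c) ∧ βC nd (decC c)) ≡ false))

  Allowed : A → Fin (2 ^ m) → Set
  Allowed x p = root x ≡ true × (∀ c → mem p c ≡ false ⊎ srcC (decC c) ≡ x) × All (NodeAllowed x p) nodes

  allowed? : ∀ x p → Dec (Allowed x p)
  allowed? x p = (root x Boolₚ.≟ true)
    ×-dec Finₚ.all? (λ c → (mem p c Boolₚ.≟ false) ⊎-dec (_≟ᶜ_ codeA (srcC (decC c)) x))
    ×-dec All.all? (λ nd →
      ((bit nd x Boolₚ.≟ true) ×-dec (k nd ≤? weight nd x p)) ⊎-dec
      ((bit nd x Boolₚ.≟ false) ×-dec (weight nd x p <? k nd) ×-dec Finₚ.all? (λ c → _ Boolₚ.≟ false))) nodes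

  -- The type is quantified because the palette need not reveal it: in a one-element structure the
  -- palette is empty.
  Ok : Fin (2 ^ m) → Set
  Ok p = ∃ λ i → Allowed (dec codeA i) p

  open Core.Spectrum Ok (λ p → Finₚ.any? λ i → allowed? (dec codeA i) p) public

  -- From models to colourings

  module Encode {n : ℕ} (t : Fin n → A) (r : Fin n → Fin n → R) where

    codeClass = codeR code-× codeR code-× codeA

    class : Fin n → Fin n → Fin (card codeClass)
    class a b = enc codeClass (r a b , r b a , t b)

    inClass : Fin n → Fin (card codeClass) → Fin n → Bool
    inClass a κ b = not (a == b) ∧ (class a b == κ)

    inOwnClass : ∀ {a b} → a ≢ b → inClass a (class a b) b ≡ true
    inOwnClass {a} {b} a≢b = ∧-intro (not-false (≢⇒== a≢b)) (==-refl (class a b))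

    rk : Fin n → Fin n → ℕ
    rk a b = rank (inClass a (class a b)) b

    index : Fin n → Fin n → Fin (suc K)
    index a b = fromℕ< {rk a b ⊓ K} (s≤s (m⊓n≤n (rk a b) K))

    toℕ-index : ∀ a b → toℕ (index a b) ≡ rk a b ⊓ K
    toℕ-index a b = Finₚ.toℕ-fromℕ< _

    colourOf : Fin n → Fin n → Colour
    colourOf a b = (t a , r a b , index a b) , (t b , r b a , index b a) , (toℕ a <ᵇ toℕ b)

    χ₀ : Fin n → Fin n → Fin m
    χ₀ a b = encC (colourOf a b)

    uses? : ∀ a c → Dec (∃ λ b → a ≢ b × χ₀ a b ≡ c)
    uses? a c = Finₚ.any? λ b → ¬? (a ≟ b) ×-dec (χ₀ a b ≟ c)

    lab : Fin n → Fin (2 ^ m)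
    lab a = fromSet (λ c → does (uses? a c))

    mem-lab : ∀ {a c} → mem (lab a) c ≡ true → ∃ λ b → a ≢ b × χ₀ a b ≡ c
    mem-lab {a} {c} e = does-true (uses? a c) (trans (sym (toSet-fromSet _ c)) e)

    lab-mem : ∀ {a b} → a ≢ b → mem (lab a) (χ₀ a b) ≡ true
    lab-mem {a} {b} a≢b = trans (toSet-fromSet (λ c → does (uses? a c)) (χ₀ a b)) (dec-true (uses? a (χ₀ a b)) (b , a≢b , refl))

    uniq-χ₀ : ∀ a b → uniq (χ₀ a b) ≡ (rk a b ⊓ K <ᵇ K)
    uniq-χ₀ a b = trans (cong uniqC (decC-encC (colourOf a b))) (cong (_<ᵇ K) (toℕ-index a b))

    uniq⇒rk< : ∀ {a b} → uniq (χ₀ a b) ≡ true → rk a b < K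
    uniq⇒rk< {a} {b} u = ≰⇒> λ le →
      <-irrefl (m≥n⇒m⊓n≡n le) (<ᵇ-true (trans (sym (uniq-χ₀ a b)) u))

    rk<⇒uniq : ∀ {a b} → rk a b < K → uniq (χ₀ a b) ≡ true
    rk<⇒uniq {a} {b} lt = trans (uniq-χ₀ a b) (true-<ᵇ (≤-trans (s≤s (m⊓n≤m (rk a b) K)) lt))

    -- Equal colours mean the same class and the same capped rank; below `K` the cap is invisible,
    -- and rank within a class is injective.
    χ₀-unique : ∀ {a b b′} → a ≢ b → a ≢ b′ → uniq (χ₀ a b) ≡ true → χ₀ a b ≡ χ₀ a b′ → b ≡ b′
    χ₀-unique {a} {b} {b′} a≢b a≢b′ u e = rank-injective (inClass a (class a b)) b b′ (inOwnClass a≢b)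
      (subst (λ κ → inClass a κ b′ ≡ true) (sym cls) (inOwnClass a≢b′))
      (trans (sym (capped lt)) (trans idx (trans (capped lt′) (cong (λ κ → rank (inClass a κ) b′) (sym cls)))))
      where
      ce : colourOf a b ≡ colourOf a b′
      ce = encC-injective e
      cls : class a b ≡ class a b′
      cls = cong (λ { ((_ , x , _) , (z , y , _) , _) → enc codeClass (x , y , z) }) ce
      idx : rk a b ⊓ K ≡ rk a b′ ⊓ K
      idx = trans (sym (toℕ-index a b)) (trans (cong (λ { ((_ , _ , i) , _) → toℕ i }) ce) (toℕ-index a b′))
      lt : rk a b < K
      lt = uniq⇒rk< u
      lt′ : rk a b′ < K
      lt′ = uniq⇒rk< (trans (cong uniq (sym e)) u)
      capped : ∀ {x} → x < K → x ⊓ K ≡ x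
      capped lt = m≤n⇒m⊓n≡m (<⇒≤ lt)

    colouring : Colouring lab
    colouring = record
      { χ        = χ₀
      ; χ-sym    = λ {a} {b} a≢b → sym (trans (rev-encC (colourOf a b))
                     (cong (λ s → encC ((t b , r b a , index b a) , (t a , r a b , index a b) , s)) (sym (<ᵇ-flip a b a≢b))))
      ; χ-mem    = lab-mem
      ; χ-exists = λ _ e → mem-lab e
      ; χ-unique = χ₀-unique }

    βC-χ₀ : ∀ nd a b → βC nd (decC (χ₀ a b)) ≡ β nd (t a) (r a b) (r b a) (t b)
    βC-χ₀ nd a b = cong (βC nd) (decC-encC (colourOf a b))

    class-β : ∀ nd a {b b′} → class a b ≡ class a b′ → β nd (t a) (r a b) (r b a) (t b) ≡ β nd (t a) (r a b′) (r b′ a) (t b′)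
    class-β nd a e = cong (λ (x , y , z) → β nd (t a) x y z) (enc-injective codeClass e)

    early : Node A R → Fin n → Fin n → Bool
    early nd a b = holds t r nd a b ∧ (rk a b <ᵇ K)

    fits≤holds : ∀ nd a → countTrue (fits nd (lab a)) ≤ countTrue (holds t r nd a)
    fits≤holds nd a = count-inj _ _ (λ c p → proj₁ (wit c p)) sat
      λ c c′ p q e → trans (sym (proj₂ (proj₂ (wit c p)))) (trans (cong (χ₀ a) e) (proj₂ (proj₂ (wit c′ q))))
      where
      wit : ∀ c → fits nd (lab a) c ≡ true → ∃ λ b → a ≢ b × χ₀ a b ≡ c
      wit c p = mem-lab (proj₁ (∧-true p))
      sat : ∀ c p → holds t r nd a (proj₁ (wit c p)) ≡ true
      sat c p with wit c p
      ... | b , a≢b , refl = ∧-intro (not-false (≢⇒== a≢b))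
              (trans (sym (βC-χ₀ nd a b)) (proj₂ (∧-true {uniq (χ₀ a b)} (proj₂ (∧-true {mem (lab a) (χ₀ a b)} p)))))

    early≤fits : ∀ nd a → countTrue (early nd a) ≤ countTrue (fits nd (lab a))
    early≤fits nd a = count-inj _ _ (λ b _ → χ₀ a b)
      (λ b p → ∧-intro (lab-mem (ne b p)) (∧-intro (u b p) (trans (βC-χ₀ nd a b) (proj₂ (∧-true {not (a == b)} (proj₁ (∧-true p)))))))
      λ b b′ p q → χ₀-unique (ne b p) (ne b′ q) (u b p)
      where
      ne : ∀ b → early nd a b ≡ true → a ≢ b
      ne b p = ==-false a b (not-true (proj₁ (∧-true (proj₁ (∧-true p)))))
      u : ∀ b → early nd a b ≡ true → uniq (χ₀ a b) ≡ true
      u b p = rk<⇒uniq (<ᵇ-true (proj₂ (∧-true {holds t r nd a b} p)))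

    class⊆holds : ∀ nd a b → holds t r nd a b ≡ true → ∀ b′ → inClass a (class a b) b′ ≡ true → holds t r nd a b′ ≡ true
    class⊆holds nd a b h b′ p with ∧-true {not (a == b′)} p
    ... | ne , e = ∧-intro ne (trans (class-β nd a (==⇒≡ _ _ e)) (proj₂ (∧-true {not (a == b)} h)))

    node-allowed : ∀ a nd → k nd ≤ K → NodeOk t r a nd → NodeAllowed (t a) (lab a) nd
    node-allowed a nd kK ok with bool? (bit nd (t a))
    ... | inj₂ f = inj₂ (f , ≤-trans (s≤s (+-monoʳ-≤ s (fits≤holds nd a))) few , none)
      where
      s = b2n (self nd (t a))
      few : s + countTrue (holds t r nd a) < k nd
      few = ≤ᵇ-false (trans (sym ok) f)
      -- A satisfying neighbour with a non-unique colour has at least `K` predecessors in its class,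
      -- all satisfying too, which is too many for a false condition.
      none : ∀ c → mem (lab a) c ∧ (not (uniq c) ∧ βC nd (decC c)) ≡ false
      none c with bool? (mem (lab a) c ∧ (not (uniq c) ∧ βC nd (decC c)))
      ... | inj₂ e = e
      ... | inj₁ e with mem-lab {a} {c} (proj₁ (∧-true e))
      ...   | b , a≢b , refl = ⊥-elim (<-irrefl refl (≤-trans few (≤-trans kK (≤-trans K≤rk (≤-trans (<⇒≤ rk<) (m≤n+m _ s))))))
        where
        e′ = ∧-true {not (uniq (χ₀ a b))} (proj₂ (∧-true {mem (lab a) (χ₀ a b)} e))
        h : holds t r nd a b ≡ true
        h = ∧-intro (not-false (≢⇒== a≢b)) (trans (sym (βC-χ₀ nd a b)) (proj₂ e′))
        K≤rk : K ≤ rk a b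
        K≤rk = ≮⇒≥ λ lt → true≢false (rk<⇒uniq lt) (not-true (proj₁ e′))
        rk< : rk a b < countTrue (holds t r nd a)
        rk< = ≤-trans (rank<count (inClass a (class a b)) b (inOwnClass a≢b)) (count-mono (class⊆holds nd a b h))
    ... | inj₁ tr = inj₁ (tr , enough)
      where
      s = b2n (self nd (t a))
      many : k nd ≤ s + countTrue (holds t r nd a)
      many = ≤ᵇ-true (trans (sym ok) tr)
      enough : k nd ≤ weight nd (t a) (lab a)
      -- If every satisfying neighbour has rank below `K`, all of them carry unique colours.
      -- Otherwise the first `K` members of one overflowing class suffice.
      enough with Finₚ.any? (λ b → (holds t r nd a b Boolₚ.≟ true) ×-dec (K ≤? rk a b))
      ... | no h = ≤-trans many (+-monoʳ-≤ s (≤-trans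
              (count-mono λ b p → ∧-intro p (true-<ᵇ (≰⇒> λ le → h (b , p , le)))) (early≤fits nd a)))
      ... | yes (b , p , le) = ≤-trans kK (≤-trans K≤ (≤-trans (early≤fits nd a) (m≤n+m _ s)))
        where
        κ = class a b
        K≤ : K ≤ countTrue (early nd a)
        K≤ = ≤-trans (count-rank (inClass a κ) K (≤-trans le (<⇒≤ (rank<count (inClass a κ) b
                 (inOwnClass (==-false a b (not-true (proj₁ (∧-true p)))))))))
               (count-mono λ b′ q → let c , l = ∧-true {inClass a κ b′} q in
                  ∧-intro (class⊆holds nd a b p b′ c)
                    (trans (cong (λ κ′ → rank (inClass a κ′) b′ <ᵇ K)
                             (==⇒≡ _ _ (proj₂ (∧-true {not (a == b′)} c)))) l))

  model⇒spec : ∀ n → Model n → Spec n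
  model⇒spec n (t , r , ok) = lab , (λ a → enc codeA (t a) , subst (λ x → Allowed x (lab a)) (sym (dec-enc codeA (t a))) (allowed a)) , colouring
    where
    open Encode t r
    allowed : ∀ a → Allowed (t a) (lab a)
    allowed a = proj₁ (ok a) , src , All.zipWith (λ {nd} (le , o) → node-allowed a nd le o) (k≤K , proj₂ (ok a))
      where
      src : ∀ c → mem (lab a) c ≡ false ⊎ srcC (decC c) ≡ t a
      src c with bool? (mem (lab a) c)
      ... | inj₂ f = inj₁ f
      ... | inj₁ e with mem-lab {a} {c} e
      ...   | b , _ , refl = inj₂ (cong srcC (decC-encC (colourOf a b)))

  -- The indices in an arbitrary colouring need not be ranks; only uniqueness of the colours
  -- matters. Both halves of a colour can be trusted, since `χ-sym` identifies the far half with the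
  -- near half seen from the other end.
  spec⇒model : ∀ n → Spec n → Model n
  spec⇒model n (lab , oks , C) = t , r , λ a → proj₁ (proj₂ (oks a)) , All.map (λ {nd} → node-ok a nd) (proj₂ (proj₂ (proj₂ (oks a))))
    where
    t : Fin n → A
    t a = dec codeA (proj₁ (oks a))
    r : Fin n → Fin n → R
    r a b = proj₁ (proj₂ (proj₁ (decC (χ C a b))))
    src : ∀ {a b} → a ≢ b → srcC (decC (χ C a b)) ≡ t a
    src {a} {b} a≢b with proj₁ (proj₂ (proj₂ (oks a))) (χ C a b)
    ... | inj₂ e = e
    ... | inj₁ f = ⊥-elim (true≢false (χ-mem C a≢b) f)
    decode-rev : ∀ {a b} → a ≢ b → decC (χ C b a) ≡ revC (decC (χ C a b))
    decode-rev a≢b = trans (cong decC (χ-sym C a≢b)) (decC-encC _)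
    βC-χ : ∀ nd {a b} → a ≢ b → βC nd (decC (χ C a b)) ≡ β nd (t a) (r a b) (r b a) (t b)
    βC-χ nd {a} {b} a≢b = trans
      (cong₂ (λ x x′ → β nd x (r a b) (proj₁ (proj₂ (proj₁ (revC (decC (χ C a b)))))) x′)
        (src a≢b) (trans (cong srcC (sym (decode-rev a≢b))) (src (a≢b ∘ sym))))
      (cong (λ z → β nd (t a) (r a b) z (t b)) (cong (λ c → proj₁ (proj₂ (proj₁ c))) (sym (decode-rev a≢b))))
    fits≤holds : ∀ nd a → countTrue (fits nd (lab a)) ≤ countTrue (holds t r nd a)
    fits≤holds nd a = count-inj _ _ (λ c p → proj₁ (wit c p)) sat
      λ c c′ p q e → trans (sym (proj₂ (proj₂ (wit c p)))) (trans (cong (χ C a) e) (proj₂ (proj₂ (wit c′ q))))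
      where
      wit : ∀ c → fits nd (lab a) c ≡ true → ∃ λ b → a ≢ b × χ C a b ≡ c
      wit c p = χ-exists C (proj₁ (∧-true (proj₂ (∧-true {mem (lab a) c} p)))) (proj₁ (∧-true p))
      sat : ∀ c p → holds t r nd a (proj₁ (wit c p)) ≡ true
      sat c p with wit c p
      ... | b , a≢b , refl = ∧-intro (not-false (≢⇒== a≢b))
              (trans (sym (βC-χ nd a≢b)) (proj₂ (∧-true {uniq (χ C a b)} (proj₂ (∧-true {mem (lab a) (χ C a b)} p)))))
    node-ok : ∀ a nd → NodeAllowed (t a) (lab a) nd → NodeOk t r a nd
    node-ok a nd (inj₁ (tr , le)) = trans tr (sym (true-≤ᵇ (≤-trans le (+-monoʳ-≤ _ (fits≤holds nd a)))))
    node-ok a nd (inj₂ (f , lt , none)) = trans f (sym (false-≤ᵇ (≤-trans (s≤s (+-monoʳ-≤ _ holds≤fits)) lt)))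
      where
      ne : ∀ b → holds t r nd a b ≡ true → a ≢ b
      ne b p = ==-false a b (not-true (proj₁ (∧-true p)))
      bt : ∀ b → holds t r nd a b ≡ true → βC nd (decC (χ C a b)) ≡ true
      bt b p = trans (βC-χ nd (ne b p)) (proj₂ (∧-true {not (a == b)} p))
      u : ∀ b → holds t r nd a b ≡ true → uniq (χ C a b) ≡ true
      u b p with bool? (uniq (χ C a b))
      ... | inj₁ e = e
      ... | inj₂ e = ⊥-elim (true≢false (∧-intro (χ-mem C (ne b p)) (∧-intro (not-false e) (bt b p))) (none (χ C a b)))
      holds≤fits : countTrue (holds t r nd a) ≤ countTrue (fits nd (lab a))
      holds≤fits = count-inj _ _ (λ b _ → χ C a b)
        (λ b p → ∧-intro (χ-mem C (ne b p)) (∧-intro (u b p) (bt b p)))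
        λ b b′ p q → χ-unique C (ne b p) (ne b′ q) (u b p)

open Node

-- From formulas to counting conditions

width : ∀ {s} → C2 s → ℕ
width (eq _ _ _ _)    = 0
width (rel i _ _ _ _) = suc i
width (una i _ _)     = suc i
width (neg φ)         = width φ
width (conj φ ψ)      = width φ ⊔ width ψ
width (cnt _ _ φ)     = width φ

-- One truth value for each counting subformula. Such a formula depends on at most one variable, so
-- its value can be stored at a single vertex.
Bits : ∀ {s} → C2 s → Set
Bits (eq _ _ _ _)    = ⊤
Bits (rel _ _ _ _ _) = ⊤
Bits (una _ _ _)     = ⊤
Bits (neg φ)         = Bits φ
Bits (conj φ ψ)      = Bits φ × Bits ψ
Bits (cnt _ _ φ)     = Bool × Bits φ

code-Bits : ∀ {s} (φ : C2 s) → Code (Bits φ)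
code-Bits (eq _ _ _ _)    = code-⊤
code-Bits (rel _ _ _ _ _) = code-⊤
code-Bits (una _ _ _)     = code-⊤
code-Bits (neg φ)         = code-Bits φ
code-Bits (conj φ ψ)      = code-Bits φ code-× code-Bits ψ
code-Bits (cnt _ _ φ)     = code-Bool code-× code-Bits φ

no-bits : ∀ {s} (φ : C2 s) → Bits φ
no-bits (eq _ _ _ _)    = tt
no-bits (rel _ _ _ _ _) = tt
no-bits (una _ _ _)     = tt
no-bits (neg φ)         = no-bits φ
no-bits (conj φ ψ)      = no-bits φ , no-bits ψ
no-bits (cnt _ _ φ)     = false , no-bits φ

-- Both variables are sent to `a`: the quantifier overwrites one of them, whichever it is, and the
-- other is the one on which the value depends.
bitsOf : ∀ {s n} → Structure n → (φ : C2 s) → Fin n → Bits φ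
bitsOf M (eq _ _ _ _)    a = tt
bitsOf M (rel _ _ _ _ _) a = tt
bitsOf M (una _ _ _)     a = tt
bitsOf M (neg φ)         a = bitsOf M φ a
bitsOf M (conj φ ψ)      a = bitsOf M φ a , bitsOf M ψ a
bitsOf M (cnt j z φ)     a = eval M (cnt j z φ) (λ _ _ → a) , bitsOf M φ a

-- Evaluation of formulas from types

module Types (L : ℕ) where

  Word : Set
  Word = Fin (2 ^ L)

  pack : (ℕ → Bool) → Word
  pack g = fromSet {L} (λ i → g (toℕ i))

  get : Word → ℕ → Bool
  get w i with i <? L
  ... | yes lt = toSet {L} w (fromℕ< lt)
  ... | no _   = false

  get-pack : ∀ g {i} → i < L → get (pack g) i ≡ g i
  get-pack g {i} lt with i <? L
  ... | yes lt′ = trans (toSet-fromSet {L} (λ i → g (toℕ i)) (fromℕ< lt′)) (cong g (Finₚ.toℕ-fromℕ< lt′))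
  ... | no ¬lt  = ⊥-elim (¬lt lt)

  Atoms : Set
  Atoms = Word × Word

  unaryWord diagonalWord : Atoms → Word
  unaryWord    = proj₁
  diagonalWord = proj₂

  -- Counting subformulas are not evaluated but looked up at the vertex named by the variable that
  -- is not quantified. The last argument says whether the two vertices coincide.
  eval′ : ∀ {s} (φ : C2 s) → Atoms → Atoms → Bits φ → Bits φ → Word → Word → Bool → Bool
  eval′ (eq vx vx _ _) x y bx by r r′ e = true
  eval′ (eq vx vy _ _) x y bx by r r′ e = e
  eval′ (eq vy vx _ _) x y bx by r r′ e = e
  eval′ (eq vy vy _ _) x y bx by r r′ e = true
  eval′ (rel i vx vx _ _) x y bx by r r′ e = get (diagonalWord x) i
  eval′ (rel i vx vy _ _) x y bx by r r′ e = get r i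
  eval′ (rel i vy vx _ _) x y bx by r r′ e = get r′ i
  eval′ (rel i vy vy _ _) x y bx by r r′ e = get (diagonalWord y) i
  eval′ (una i vx _) x y bx by r r′ e = get (unaryWord x) i
  eval′ (una i vy _) x y bx by r r′ e = get (unaryWord y) i
  eval′ (neg φ) x y bx by r r′ e = not (eval′ φ x y bx by r r′ e)
  eval′ (conj φ ψ) x y (bx , bx′) (by , by′) r r′ e = eval′ φ x y bx by r r′ e ∧ eval′ ψ x y bx′ by′ r r′ e
  eval′ (cnt k vx φ) x y bx by r r′ e = proj₁ by
  eval′ (cnt k vy φ) x y bx by r r′ e = proj₁ bx

  module Nodes {A : Set} (atoms : A → Atoms) where

    at : ∀ {s} (φ : C2 s) → (A → Bits φ) → A → A → Word → Word → Bool → Bool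
    at φ bits x y = eval′ φ (atoms x) (atoms y) (bits x) (bits y)

    on-diagonal : ∀ {s} (φ : C2 s) → (A → Bits φ) → A → Bool
    on-diagonal φ bits x = at φ bits x x (diagonalWord (atoms x)) (diagonalWord (atoms x)) true

    node : ∀ {s} → ℕ → (z : Var) (φ : C2 (bind s z)) → (A → Bool × Bits φ) → Node A Word
    node {s} n z φ bits = record
      { k    = n
      ; bit  = proj₁ ∘ bits
      ; self = on-diagonal φ (proj₂ ∘ bits)
      ; β    = edge z φ (proj₂ ∘ bits) }
      where
      edge : ∀ z (φ : C2 (bind s z)) → (A → Bits φ) → A → Word → Word → A → Bool
      -- When `vx` is counted, the vertex that carries the node plays the role of `y` and its
      -- neighbour that of `x`.
      edge vx φ bits x r r′ y = at φ bits y x r′ r false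
      edge vy φ bits x r r′ y = at φ bits x y r r′ false

    nodes : ∀ {s} (φ : C2 s) → (A → Bits φ) → List (Node A Word)
    nodes (eq _ _ _ _)    bits = []
    nodes (rel _ _ _ _ _) bits = []
    nodes (una _ _ _)     bits = []
    nodes (neg φ)         bits = nodes φ bits
    nodes (conj φ ψ)      bits = nodes φ (proj₁ ∘ bits) List.++ nodes ψ (proj₂ ∘ bits)
    nodes {s} (cnt n z φ) bits = node {s} n z φ bits ∷ nodes φ (proj₂ ∘ bits)

    module Correct {n : ℕ} (M : Structure n) (t : Fin n → A) (r : Fin n → Fin n → Word)
      (un : ∀ {i} → i < L → ∀ a → get (unaryWord (atoms (t a))) i ≡ unary M i a)
      (dg : ∀ {i} → i < L → ∀ a → get (diagonalWord (atoms (t a))) i ≡ binary M i a a)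
      (bn : ∀ {i} → i < L → ∀ a b → a ≢ b → get (r a b) i ≡ binary M i a b)
      where

      -- Colours describe distinct vertices only, so loops are stored in the types and merged in
      -- here.
      word : Fin n → Fin n → Word
      word a b = if a == b then diagonalWord (atoms (t a)) else r a b

      word-≢ : ∀ {a b} → a ≢ b → word a b ≡ r a b
      word-≢ {a} a≢b = cong (λ c → if c then diagonalWord (atoms (t a)) else _) (≢⇒== a≢b)

      word-diagonal : ∀ a → word a a ≡ diagonalWord (atoms (t a))
      word-diagonal a = cong (λ c → if c then diagonalWord (atoms (t a)) else r a a) (==-refl a)

      get-word : ∀ {i} → i < L → ∀ a b → get (word a b) i ≡ binary M i a b
      get-word lt a b with a ≟ b
      ... | yes refl = dg lt a
      ... | no a≢b   = bn lt a b a≢b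

      full : ∀ {s} (φ : C2 s) → (A → Bits φ) → Fin n → Fin n → Bool
      full φ bits a b = at φ bits (t a) (t b) (word a b) (word b a) (a == b)

      off-diagonal : ∀ {s} (φ : C2 s) bits {a b} → a ≢ b →
        at φ bits (t a) (t b) (r a b) (r b a) false ≡ full φ bits a b
      off-diagonal φ bits {a} {b} a≢b
        rewrite word-≢ a≢b | word-≢ (a≢b ∘ sym) | ≢⇒== a≢b = refl

      diagonal : ∀ {s} (φ : C2 s) bits a → on-diagonal φ bits (t a) ≡ full φ bits a a
      diagonal φ bits a rewrite word-diagonal a | ==-refl a = refl

      guarded : ∀ {a b : Fin n} {f g : Bool} → (a ≢ b → f ≡ g) → not (a == b) ∧ f ≡ not (a == b) ∧ g
      guarded {a} {b} h with a ≟ b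
      ... | yes _  = refl
      ... | no a≢b = h a≢b

      pair : Var → Fin n → Fin n → Fin n × Fin n
      pair vx a b = b , a
      pair vy a b = a , b

      -- The vertex itself is split off from the count by `count-∖`; it becomes the `self` summand.
      node-count : ∀ {s} j z (φ : C2 (bind s z)) bits a →
        b2n (self (node {s} j z φ bits) (t a)) + countTrue (holds t r (node {s} j z φ bits) a)
          ≡ countTrue (λ b → full φ (proj₂ ∘ bits) (proj₁ (pair z a b)) (proj₂ (pair z a b)))
      node-count j vx φ bits a = trans (cong₂ _+_ (cong b2n (diagonal φ (proj₂ ∘ bits) a))
          (count-cong λ b → guarded {a} {b} λ a≢b → off-diagonal φ (proj₂ ∘ bits) (a≢b ∘ sym)))
        (sym (count-∖ (λ b → full φ (proj₂ ∘ bits) b a) a))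
      node-count j vy φ bits a = trans (cong₂ _+_ (cong b2n (diagonal φ (proj₂ ∘ bits) a))
          (count-cong λ b → guarded {a} {b} λ a≢b → off-diagonal φ (proj₂ ∘ bits) a≢b))
        (sym (count-∖ (λ b → full φ (proj₂ ∘ bits) a b) a))

      ≡ᶠ-== : ∀ {n} (a b : Fin n) → (a ≡ᶠ b) ≡ (a == b)
      ≡ᶠ-== zero    zero    = refl
      ≡ᶠ-== zero    (suc b) = refl
      ≡ᶠ-== (suc a) zero    = refl
      ≡ᶠ-== (suc a) (suc b) = ≡ᶠ-== a b

      NodesOk : ∀ {s} (φ : C2 s) → (A → Bits φ) → Set
      NodesOk φ bits = ∀ a → All (NodeOk t r a) (nodes φ bits)

      -- Variables out of scope are unconstrained, so a sentence may be evaluated at any pair of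
      -- vertices.
      Assigns : ∀ {s} → Env s n → Fin n → Fin n → Set
      Assigns ρ a b = (∀ p → ρ vx p ≡ a) × (∀ p → ρ vy p ≡ b)

      -- The claimed bits are correct by induction: the condition at a node relates its bit to the
      -- values of its body, and those depend only on bits of smaller subformulas.
      full-eval : ∀ {s} (φ : C2 s) bits → width φ ≤ L → NodesOk φ bits → ∀ {ρ a b} → Assigns ρ a b →
        full φ bits a b ≡ eval M φ ρ
      full-eval (eq vx vx p q) bits w ok {ρ} {a} {b} (x , y)
        rewrite x p | x q = sym (trans (≡ᶠ-== a a) (==-refl a))
      full-eval (eq vx vy p q) bits w ok {ρ} {a} {b} (x , y)
        rewrite x p | y q = sym (≡ᶠ-== a b)
      full-eval (eq vy vx p q) bits w ok {ρ} {a} {b} (x , y)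
        rewrite y p | x q = sym (trans (≡ᶠ-== b a) (==-sym b a))
      full-eval (eq vy vy p q) bits w ok {ρ} {a} {b} (x , y)
        rewrite y p | y q = sym (trans (≡ᶠ-== b b) (==-refl b))
      full-eval (rel i vx vx p q) bits w ok {ρ} {a} {b} (x , y) rewrite x p | x q = dg w a
      full-eval (rel i vx vy p q) bits w ok {ρ} {a} {b} (x , y) rewrite x p | y q = get-word w a b
      full-eval (rel i vy vx p q) bits w ok {ρ} {a} {b} (x , y) rewrite y p | x q = get-word w b a
      full-eval (rel i vy vy p q) bits w ok {ρ} {a} {b} (x , y) rewrite y p | y q = dg w b
      full-eval (una i vx p) bits w ok {ρ} {a} {b} (x , y) rewrite x p = un w a
      full-eval (una i vy p) bits w ok {ρ} {a} {b} (x , y) rewrite y p = un w b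
      full-eval (neg φ) bits w ok as = cong not (full-eval φ bits w ok as)
      full-eval (conj φ ψ) bits w ok as = cong₂ _∧_
        (full-eval φ (proj₁ ∘ bits) (m⊔n≤o⇒m≤o _ _ w) (λ a → Allₚ.++⁻ˡ (nodes φ (proj₁ ∘ bits)) (ok a)) as)
        (full-eval ψ (proj₂ ∘ bits) (m⊔n≤o⇒n≤o (width φ) _ w) (λ a → Allₚ.++⁻ʳ (nodes φ (proj₁ ∘ bits)) (ok a)) as)
      full-eval {s} (cnt j vx φ) bits w ok {ρ} {a} {b} (x , y) =
        trans (All.head (ok b)) (cong (j ≤ᵇ_) (trans (node-count {s} j vx φ bits b)
          (count-cong {n} λ c → full-eval φ (proj₂ ∘ bits) w (λ a → All.tail (ok a)) {extend {s} ρ vx c} ((λ _ → refl) , y))))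
      full-eval {s} (cnt j vy φ) bits w ok {ρ} {a} {b} (x , y) =
        trans (All.head (ok a)) (cong (j ≤ᵇ_) (trans (node-count {s} j vy φ bits a)
          (count-cong {n} λ c → full-eval φ (proj₂ ∘ bits) w (λ a → All.tail (ok a)) {extend {s} ρ vy c} (x , λ _ → refl))))

      bits-ok : ∀ {s} (φ : C2 s) bits → width φ ≤ L → (∀ a → bits (t a) ≡ bitsOf M φ a) → NodesOk φ bits
      bits-ok (eq _ _ _ _)    bits w h a = []
      bits-ok (rel _ _ _ _ _) bits w h a = []
      bits-ok (una _ _ _)     bits w h a = []
      bits-ok (neg φ)         bits w h a = bits-ok φ bits w h a
      bits-ok (conj φ ψ)      bits w h a = Allₚ.++⁺
        (bits-ok φ (proj₁ ∘ bits) (m⊔n≤o⇒m≤o _ _ w) (λ a → cong proj₁ (h a)) a)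
        (bits-ok ψ (proj₂ ∘ bits) (m⊔n≤o⇒n≤o (width φ) _ w) (λ a → cong proj₂ (h a)) a)
      bits-ok {s} (cnt j vx φ) bits w h a = trans (cong proj₁ (h a)) (cong (j ≤ᵇ_) (sym (trans
          (node-count {s} j vx φ bits a)
          (count-cong {n} λ c → full-eval φ (proj₂ ∘ bits) w rest {extend {s} (λ _ _ → a) vx c} ((λ _ → refl) , λ _ → refl))))) ∷ rest a
        where rest = bits-ok φ (proj₂ ∘ bits) w (λ a → cong proj₂ (h a))
      bits-ok {s} (cnt j vy φ) bits w h a = trans (cong proj₁ (h a)) (cong (j ≤ᵇ_) (sym (trans
          (node-count {s} j vy φ bits a)
          (count-cong {n} λ c → full-eval φ (proj₂ ∘ bits) w rest {extend {s} (λ _ _ → a) vy c} ((λ _ → refl) , λ _ → refl))))) ∷ rest a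
        where rest = bits-ok φ (proj₂ ∘ bits) w (λ a → cong proj₂ (h a))

-- Sentences in normal form

module Translate (φ : Sentence) where

  open Types (width φ)
  open Nodes {Atoms × Bits φ} proj₁

  word₀ : Word
  word₀ = pack (λ _ → false)

  open NormalForm ((code-Fin _ code-× code-Fin _) code-× code-Bits φ) (code-Fin _) ((word₀ , word₀) , no-bits φ) word₀
    (nodes φ proj₂) (on-diagonal φ proj₂) public using (Model; CountSpec; countSpecD; count⇒spec; spec⇒count; model⇒spec; spec⇒model)

  inSpec⇒model : ∀ n → InSpec φ n → Model n
  inSpec⇒model n (M , sat) = t , r , λ a →
      trans (C.diagonal φ proj₂ a) (trans (C.full-eval φ proj₂ ≤-refl ok ((λ ()) , (λ ()))) (Equivalence.to Boolₚ.T-≡ sat)) , ok a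
    where
    atoms : Fin n → Atoms
    atoms a = pack (λ i → unary M i a) , pack (λ i → binary M i a a)
    r : Fin n → Fin n → Word
    r a b = pack (λ i → binary M i a b)
    t : Fin n → Atoms × Bits φ
    t a = atoms a , bitsOf M φ a
    module C = Correct M t r
      (λ lt a → get-pack (λ i → unary M i a) lt) (λ lt a → get-pack (λ i → binary M i a a) lt)
      (λ lt a b _ → get-pack (λ i → binary M i a b) lt)
    ok : C.NodesOk φ proj₂
    ok = C.bits-ok φ proj₂ ≤-refl (λ _ → refl)

  -- The size is positive so that there is a vertex, `zero`, at which to read off the root
  -- condition.
  model⇒inSpec : ∀ n → Model (suc n) → InSpec φ (suc n)
  model⇒inSpec n (t , r , h) = M , Equivalence.from Boolₚ.T-≡
      (trans (sym (C.full-eval φ proj₂ ≤-refl (λ a → proj₂ (h a)) ((λ ()) , (λ ()))))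
             (trans (sym (C.diagonal φ proj₂ zero)) (proj₁ (h zero))))
    where
    M : Structure (suc n)
    M = record
      { unary  = λ i a → get (unaryWord (proj₁ (t a))) i
      ; binary = λ i a b → get (if a == b then diagonalWord (proj₁ (t a)) else r a b) i }
    module C = Correct M t r (λ _ _ → refl)
      (λ {i} _ a → cong (λ c → get (if c then diagonalWord (proj₁ (t a)) else r a a) i) (sym (==-refl a)))
      (λ {i} _ a b a≢b → cong (λ c → get (if c then diagonalWord (proj₁ (t a)) else r a b) i) (sym (≢⇒== a≢b)))

-- The empty structure and the spectrum formula

empty : Structure 0
empty = record { unary = λ _ () ; binary = λ _ () }

eval-empty : ∀ (φ : Sentence) (M : Structure 0) ρ → eval M φ ρ ≡ eval empty φ ρ
eval-empty (eq vx _ () _)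
eval-empty (eq vy _ () _)
eval-empty (rel _ vx _ () _)
eval-empty (rel _ vy _ () _)
eval-empty (una _ vx ())
eval-empty (una _ vy ())
eval-empty (neg φ)    M ρ = cong not (eval-empty φ M ρ)
eval-empty (conj φ ψ) M ρ = cong₂ _∧_ (eval-empty φ M ρ) (eval-empty ψ M ρ)
eval-empty (cnt k z φ) M ρ = refl

-- Counts decide all positive sizes. Whether 0 belongs to the spectrum is computed from `φ` by
-- evaluation in the empty structure, before the formula is chosen.
spectrumD : (φ : Sentence) → Defn (λ n → n ∷ []) (InSpec φ)
spectrumD φ = by-cases (bool? (eval empty φ emptyEnv))
  where
  open Translate φ
  n-term : TermFor (λ n → n ∷ []) (λ n → n)
  n-term = record { term = var zero ; correct = λ _ → refl }
  nonempty : ∀ n → CountSpec (suc n) → InSpec φ (suc n)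
  nonempty n h = model⇒inSpec n (spec⇒model (suc n) (count⇒spec (suc n) h))
  counts : ∀ n → InSpec φ n → CountSpec n
  counts n h = spec⇒count n (model⇒spec n (inSpec⇒model n h))
  by-cases : eval empty φ emptyEnv ≡ true ⊎ eval empty φ emptyEnv ≡ false → Defn (λ n → n ∷ []) (InSpec φ)
  by-cases (inj₁ e) = record
    { form     = Defn.form (countSpecD n-term)
    ; sound    = λ { zero _ → empty , Equivalence.from Boolₚ.T-≡ e
                   ; (suc n) p → nonempty n (Defn.sound (countSpecD n-term) (suc n) p) }
    ; complete = λ n h → Defn.complete (countSpecD n-term) n (counts n h) }
  by-cases (inj₂ e) = record
    { form     = Defn.form d
    ; sound    = λ n p → snd n (Defn.sound d n p)
    ; complete = λ n h → Defn.complete d n (positive n h , counts n h) }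
    where
    -- The conjunct `1 ≤ n` excludes size 0, where the conditions on counts could hold vacuously.
    d = DecDefn.defn (constT 1 ≤D n-term) ∩ countSpecD n-term
    snd : ∀ n → 1 ≤ n × CountSpec n → InSpec φ n
    snd (suc n) (_ , h) = nonempty n h
    positive : ∀ n → InSpec φ n → 1 ≤ n
    positive zero    (M , sat) = ⊥-elim (true≢false (Equivalence.to Boolₚ.T-≡ sat) (trans (eval-empty φ M emptyEnv) e))
    positive (suc n) _         = s≤s z≤n

theorem1 : Σ (Sentence → PForm 1) λ PREB →
    (φ : Sentence) (n : ℕ) → PSat (PREB φ) (n ∷ []) ⇔ InSpec φ n
theorem1 = (λ φ → Defn.form (spectrumD φ)) ,
  λ φ n → mk⇔ (Defn.sound (spectrumD φ) n) (Defn.complete (spectrumD φ) n)
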